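{- Let $\mathfrak A$ be an $\aleph_0$-categorical, non-contractible structure and let $\mathfrak B$ be a structure. Then the following are equivalent: (1) $\mathfrak B$ is positive existentially interpretable in $\mathfrak A$; (2) there is a continuous monoid homomorphism $f:\mathrm{End}(\mathfrak A)\to\mathrm{End}(\mathfrak B)$ such that $B$ is covered by finitely many orbits under the image $f[\mathrm{End}(\mathfrak A)]$; (3) there is a continuous monoid homomorphism $f:\mathrm{End}(\mathfrak A)\to\mathrm{End}(\mathfrak B)$ such that $B$ is covered by finitely many orbits under $f[\mathrm{Aut}(\mathfrak A)]$.
   Context: All structures are in an at most countable signature without function symbols (relation symbols, possibly constants); $A,B$ denote the universes of $\mathfrak A,\mathfrak B$. A structure is called $\aleph_0$-categorical if it is finite or a countable model of an $\aleph_0$-categorical theory in an at most countable language. An $\aleph_0$-categorical structure is called contractible if it has a constant endomorphism. Definability is without parameters. $\mathrm{Aut}(\mathfrak M)$ is the automorphism group and $\mathrm{End}(\mathfrak M)$ the monoid of endomorphisms (homomorphisms $\mathfrak M\to\mathfrak M$). Maps act from the right: $x^{\sigma}=\sigma(x)$, $x^{\sigma\tau}=\tau(\sigma(x))$. These monoids carry the topology of pointwise convergence, with basic open sets $U_{\bar a,\bar b}=\{\sigma\mid \bar a^\sigma=\bar b\}$ for finite tuples $\bar a,\bar b$. For a set $\Sigma$ of maps $B\to B$, the orbit of $b\in B$ under $\Sigma$ is $\{b^\sigma\mid\sigma\in\Sigma\}$. The basic sets of a structure are its universe, the diagonal (equality relation), the interpretations of the relation symbols, and the (graphs of the) interpretations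 of the constants. An interpretation of $\mathfrak B$ in $\mathfrak A$ is a surjection $i:U\to B$ with $U\subseteq A^n$ for some $n$, such that the inverse images under $i$ (taken componentwise) of all basic sets of $\mathfrak B$ are definable in $\mathfrak A$; it is positive existential if all these inverse images are definable in $\mathfrak A$ by positive existential formulas (formulas built from atomic formulas, including equalities, $\top$ and $\bot$, using $\wedge,\vee,\exists$). $\mathfrak B$ is positive existentially interpretable in $\mathfrak A$ if such a positive existential interpretation exists. -}

module Defs where

open import Algebra.Bundles using (Monoid)
open import Algebra.Morphism.Structures using (module MonoidMorphisms)
open import Data.Empty using (⊥)
open import Data.Fin.Base using (Fin)
open import Data.List.Base using (List)
open import Data.List.Relation.Unary.Any using (Any)
open import Data.Nat.Base using (ℕ; suc; _*_)
open import Data.Product.Base using (Σ-syntax; ∃; ∃-syntax; _×_; _,_; proj₁)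
open import Data.Sum.Base using (_⊎_)
open import Data.Unit.Base using (⊤)
open import Data.Vec.Base using (Vec; []; _∷_; lookup; map; concat)
open import Data.Vec.Properties using (map-id; map-∘)
open import Data.Vec.Relation.Binary.Pointwise.Inductive using (Pointwise)
open import Function.Base using (_∘_; id)
open import Function.Bundles using (_↔_; _↣_; _⇔_; Surjection)
open import Function.Definitions using (Bijective)
open import Level using (0ℓ)
open import Relation.Binary.PropositionalEquality
  using (_≡_; refl; sym; trans; cong; subst; setoid)
import Relation.Binary.Construct.On as On
open import Relation.Nullary.Negation.Core using (¬_)
open import Relation.Unary using (Pred; _∈_; _⊆_)

AtMostCountable : Set → Set
AtMostCountable X = X ↣ ℕ

CountablyInfinite : Set → Set
CountablyInfinite X = X ↔ ℕ

Finite : Set → Set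
Finite X = ∃[ n ] (X ↔ Fin n)

record Signature : Set₁ where
  field
    Rel            : Set
    arity          : Rel → ℕ
    Const          : Set
    rel-countable   : AtMostCountable Rel
    const-countable : AtMostCountable Const

-- Universes are nonempty, as usual in model theory.
record Structure (S : Signature) : Set₁ where
  open Signature S
  field
    Carrier  : Set
    rel      : (r : Rel) → Pred (Vec Carrier (arity r)) 0ℓ
    const    : Const → Carrier
    nonempty : Carrier

open Structure using (Carrier)

module _ {S : Signature} where
  open Signature S

  record IsHomomorphism (M N : Structure S) (h : Carrier M → Carrier N) : Set where
    private
      module M = Structure M
      module N = Structure N
    field
      rel-preserved   : ∀ r {xs} → M.rel r xs → N.rel r (map h xs)
      const-preserved : ∀ c → h (M.const c) ≡ N.const c

  record IsIsomorphism (M N : Structure S) (h : Carrier M → Carrier N) : Set where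
    private
      module M = Structure M
      module N = Structure N
    field
      isHomomorphism : IsHomomorphism M N h
      bijective      : Bijective _≡_ _≡_ h
      rel-reflected  : ∀ r {xs} → N.rel r (map h xs) → M.rel r xs

  _≅_ : Structure S → Structure S → Set
  M ≅ N = ∃[ h ] IsIsomorphism M N h

module _ (S : Signature) where
  open Signature S

  data Term (n : ℕ) : Set where
    var : Fin n → Term n
    con : Const → Term n

  -- Formula n: free variables among the n de Bruijn indices.
  data Formula (n : ℕ) : Set where
    ⊤′ ⊥′     : Formula n
    _≐_       : Term n → Term n → Formula n
    rel       : (r : Rel) → Vec (Term n) (arity r) → Formula n
    ¬′_       : Formula n → Formula n
    _∧′_ _∨′_ : Formula n → Formula n → Formula n
    ∀′_ ∃′_   : Formula (suc n) → Formula n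

  Sentence : Set
  Sentence = Formula 0

  Theory : Set₁
  Theory = Pred Sentence 0ℓ

module _ {S : Signature} where

  data IsPositiveExistential {n : ℕ} : Formula S n → Set where
    ⊤′   : IsPositiveExistential ⊤′
    ⊥′   : IsPositiveExistential ⊥′
    _≐_  : ∀ s t → IsPositiveExistential (s ≐ t)
    rel  : ∀ r ts → IsPositiveExistential (rel r ts)
    _∧′_ : ∀ {φ ψ} → IsPositiveExistential φ → IsPositiveExistential ψ →
           IsPositiveExistential (φ ∧′ ψ)
    _∨′_ : ∀ {φ ψ} → IsPositiveExistential φ → IsPositiveExistential ψ →
           IsPositiveExistential (φ ∨′ ψ)
    ∃′_  : ∀ {φ} → IsPositiveExistential φ → IsPositiveExistential (∃′ φ)

module _ {S : Signature} (M : Structure S) where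
  private module M = Structure M

  eval : ∀ {n} → Vec M.Carrier n → Term S n → M.Carrier
  eval ρ (var i) = lookup ρ i
  eval ρ (con c) = M.const c

  Sat : ∀ {n} → Formula S n → Vec M.Carrier n → Set
  Sat ⊤′         ρ = ⊤
  Sat ⊥′         ρ = ⊥
  Sat (s ≐ t)    ρ = eval ρ s ≡ eval ρ t
  Sat (rel r ts) ρ = M.rel r (map (eval ρ) ts)
  Sat (¬′ φ)     ρ = ¬ Sat φ ρ
  Sat (φ ∧′ ψ)   ρ = Sat φ ρ × Sat ψ ρ
  Sat (φ ∨′ ψ)   ρ = Sat φ ρ ⊎ Sat ψ ρ
  Sat (∀′ φ)     ρ = ∀ x → Sat φ (x ∷ ρ)
  Sat (∃′ φ)     ρ = ∃[ x ] Sat φ (x ∷ ρ)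

  _⊨_ : Theory S → Set
  _⊨_ T = ∀ {φ} → φ ∈ T → Sat φ []

  -- A subset of (Mⁿ)ᵏ is regarded as a subset of Mᵏⁿ.
  DefinedBy : ∀ {n k} → Formula S (k * n) → Pred (Vec (Vec M.Carrier n) k) 0ℓ → Set
  DefinedBy φ P = ∀ xss → Sat φ (concat xss) ⇔ P xss

  Definable : ∀ {n k} → Pred (Vec (Vec M.Carrier n) k) 0ℓ → Set
  Definable P = ∃[ φ ] DefinedBy φ P

  PEDefinable : ∀ {n k} → Pred (Vec (Vec M.Carrier n) k) 0ℓ → Set
  PEDefinable P = ∃[ φ ] (IsPositiveExistential φ × DefinedBy φ P)

module _ {S : Signature} where

  record Isℵ₀CategoricalTheory (T : Theory S) : Set₁ where
    field
      model  : ∃[ M ] (CountablyInfinite (Carrier M) × M ⊨ T)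
      unique : ∀ M N → CountablyInfinite (Carrier M) → CountablyInfinite (Carrier N) →
               M ⊨ T → N ⊨ T → M ≅ N

  Isℵ₀Categorical : Structure S → Set₁
  Isℵ₀Categorical M =
    Finite (Carrier M) ⊎
    (CountablyInfinite (Carrier M) × Σ[ T ∈ Theory S ] (Isℵ₀CategoricalTheory T × M ⊨ T))

module _ {S : Signature} (M : Structure S) where
  private module M = Structure M

  record Endomorphism : Set where
    field
      fun            : M.Carrier → M.Carrier
      isHomomorphism : IsHomomorphism M M fun
    open IsHomomorphism isHomomorphism public

  open Endomorphism

  idEnd : Endomorphism
  idEnd = record
    { fun            = id
    ; isHomomorphism = record
      { rel-preserved   = λ r {xs} → subst (M.rel r) (sym (map-id xs))
      ; const-preserved = λ c → refl
      }
    }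

  -- Maps act from the right: σ ∙ τ applies σ first.
  compEnd : Endomorphism → Endomorphism → Endomorphism
  compEnd σ τ = record
    { fun            = fun τ ∘ fun σ
    ; isHomomorphism = record
      { rel-preserved   = λ r {xs} p →
          subst (M.rel r) (sym (map-∘ (fun τ) (fun σ) xs))
                (rel-preserved τ r (rel-preserved σ r p))
      ; const-preserved = λ c →
          trans (cong (fun τ) (const-preserved σ c)) (const-preserved τ c)
      }
    }

  -- Two endomorphisms are equal when their underlying maps agree pointwise.
  End : Monoid 0ℓ 0ℓ
  End = record
    { Carrier  = Endomorphism
    ; _≈_      = λ σ τ → ∀ x → fun σ x ≡ fun τ x
    ; _∙_      = compEnd
    ; ε        = idEnd
    ; isMonoid = record
      { isSemigroup = record
        { isMagma = record
          { isEquivalence = record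
            { refl  = λ x → refl
            ; sym   = λ p x → sym (p x)
            ; trans = λ p q x → trans (p x) (q x)
            }
          ; ∙-cong = λ {_} {_} {τ} p q x → trans (cong (fun τ) (p x)) (q _)
          }
        ; assoc = λ _ _ _ x → refl
        }
      ; identity = (λ _ x → refl) , (λ _ x → refl)
      }
    }

  Aut : Pred Endomorphism 0ℓ
  Aut σ = IsIsomorphism M M (fun σ)

  IsContractible : Set
  IsContractible = Σ[ σ ∈ Endomorphism ] ∃[ c ] (∀ x → fun σ x ≡ c)

  BasicOpen : ∀ {n} → Vec M.Carrier n → Vec M.Carrier n → Pred Endomorphism 0ℓ
  BasicOpen as bs σ = map (fun σ) as ≡ bs

  IsOpen : Pred Endomorphism 0ℓ → Set
  IsOpen O = ∀ {σ} → σ ∈ O →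
    ∃[ n ] Σ[ as ∈ Vec M.Carrier n ] Σ[ bs ∈ Vec M.Carrier n ]
      (σ ∈ BasicOpen as bs × BasicOpen as bs ⊆ O)

  Orbit : Pred Endomorphism 0ℓ → M.Carrier → Pred M.Carrier 0ℓ
  Orbit Φ b c = ∃[ σ ] (σ ∈ Φ × fun σ b ≡ c)

  CoveredByFinitelyManyOrbits : Pred Endomorphism 0ℓ → Set
  CoveredByFinitelyManyOrbits Φ =
    Σ[ bs ∈ List M.Carrier ] (∀ c → Any (λ b → c ∈ Orbit Φ b) bs)

module _ {S S′ : Signature} (M : Structure S) (N : Structure S′) where

  Continuous : (Endomorphism M → Endomorphism N) → Set₁
  Continuous f = ∀ (O : Pred (Endomorphism N) 0ℓ) → IsOpen N O → IsOpen M (O ∘ f)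

  record ContinuousHomomorphism : Set₁ where
    private
      module EM = Monoid (End M)
      module EN = Monoid (End N)
    open MonoidMorphisms EM.rawMonoid EN.rawMonoid using (IsMonoidHomomorphism)
    field
      ⟦_⟧                  : Endomorphism M → Endomorphism N
      isMonoidHomomorphism : IsMonoidHomomorphism ⟦_⟧
      continuous           : Continuous ⟦_⟧

    image : Pred (Endomorphism M) 0ℓ → Pred (Endomorphism N) 0ℓ
    image Φ τ = ∃[ σ ] (σ ∈ Φ × ⟦ σ ⟧ EN.≈ τ)

module _ {S : Signature} where
  open Signature S

  data BasicSet : Set where
    universe diagonal : BasicSet
    relation          : Rel → BasicSet
    constant          : Const → BasicSet

  dimension : BasicSet → ℕ
  dimension universe     = 1
  dimension diagonal     = 2
  dimension (relation r) = arity r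
  dimension (constant c) = 1

  basicSet : (N : Structure S) (β : BasicSet) → Pred (Vec (Carrier N) (dimension β)) 0ℓ
  basicSet N universe     _             = ⊤
  basicSet N diagonal     (x ∷ y ∷ []) = x ≡ y
  basicSet N (relation r) xs            = Structure.rel N r xs
  basicSet N (constant c) (x ∷ [])      = x ≡ Structure.const N c

-- An interpretation of N in M.
record Interpretation {S S′ : Signature} (N : Structure S′) (M : Structure S) : Set₁ where
  field
    n   : ℕ
    Dom : Pred (Vec (Carrier M) n) 0ℓ
    -- Elements of the subset are compared by their underlying tuples,
    -- so the map cannot depend on the proof of membership.
    map-onto : Surjection (On.setoid (setoid (Vec (Carrier M) n)) (proj₁ {B = Dom}))
                          (setoid (Carrier N))

  Graph : Vec (Carrier M) n → Carrier N → Set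
  Graph x y = Σ[ p ∈ Dom x ] Surjection.to map-onto (x , p) ≡ y

  preimage : ∀ {k} → Pred (Vec (Carrier N) k) 0ℓ → Pred (Vec (Vec (Carrier M) n) k) 0ℓ
  preimage P xs = ∃[ ys ] (Pointwise Graph xs ys × ys ∈ P)

  field
    definable : ∀ β → Definable M (preimage (basicSet N β))

  IsPositiveExistentialInterpretation : Set
  IsPositiveExistentialInterpretation = ∀ β → PEDefinable M (preimage (basicSet N β))

PositiveExistentiallyInterpretable :
  {S S′ : Signature} → Structure S′ → Structure S → Set₁
PositiveExistentiallyInterpretable N M =
  Σ[ I ∈ Interpretation N M ] Interpretation.IsPositiveExistentialInterpretation I

{-# OPTIONS --safe #-}
module Submission where

-- An interpretation of 𝔅 in 𝔄 by positive existential formulas transports the action of End 𝔄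
-- on tuples to 𝔅, with finitely many Aut 𝔄-orbits by the Ryll-Nardzewski theorem.
-- Conversely, given a continuous f, compactness of End 𝔄 modulo Aut 𝔄 yields a finite tuple ā
-- such that b^f(σ) depends only on ā^σ, for each b in a finite set of orbit generators, and
-- non-contractibility makes it possible to choose ā without constant images. Then b^f(σ) is coded
-- by ā^σ in the block belonging to b, all other blocks being constant. All relations to be defined
-- are invariant under End 𝔄, and such relations are positive existentially definable, because
-- finiteness of the number of orbits isolates the positive existential types.
--
-- The Ryll-Nardzewski theorem is proved without a deduction system: a Henkin construction forces
-- with finite sets of formulas satisfiable in 𝔄, once to omit a non-isolated type (so that 𝔄 realises
-- only isolated ones), and once to realise a limit of infinitely many orbits.

open import Defs
open import Algebra.Bundles using (Monoid)
open import Algebra.Morphism.Structures using (module MonoidMorphisms)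
open import Axiom.ExcludedMiddle using (ExcludedMiddle)
open import Data.Empty using (⊥)
open import Data.Fin.Base using (Fin; zero; suc; toℕ; fromℕ<; _↑ˡ_; _↑ʳ_; combine; remQuot)
open import Data.Fin.Properties
  using (toℕ<n; toℕ-fromℕ<; fromℕ<-toℕ; toℕ-injective; remQuot-combine; _≟_)
open import Data.List.Base as List
  using (List; []; _∷_; upTo; concatMap; cartesianProductWith; allFin)
open import Data.List.Membership.Propositional using (_∈_; lose; find)
open import Data.List.Membership.Propositional.Properties
  using (∈-map⁺; ∈-++⁺ˡ; ∈-++⁺ʳ; ∈-concat⁺; ∈-concatMap⁺; ∈-cartesianProductWith⁺; ∈-upTo⁺;
         ∈-allFin; ∈-lookup)
open import Data.List.Relation.Binary.Subset.Propositional using (_⊆_)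
open import Data.List.Relation.Unary.All as All using (All; []; _∷_)
open import Data.List.Relation.Unary.All.Properties as All using (++⁺; ++⁻ˡ; ++⁻ʳ)
open import Data.List.Relation.Unary.Any as Any using (Any; here; there)
open import Data.List.Relation.Unary.Any.Properties as Any using (lookup-index)
open import Data.Nat.Base
  using (ℕ; zero; suc; _+_; _*_; _≤_; _<_; _⊔_; s≤s; _≤′_; ≤′-refl; ≤′-step)
open import Data.Nat.Properties
  using (≤-refl; ≤-trans; <-≤-trans; <-irrefl; _<?_; ≤⇒≤′; m≤m⊔n; m≤n⊔m; m≤n+m; m≤n⇒m≤1+n;
         m<1+n⇒m<n∨m≡n; +-cancelʳ-≡)
open import Data.Product.Base using (Σ; Σ-syntax; ∃; ∃-syntax; _×_; _,_; proj₁; proj₂)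
open import Data.Sum.Base using (_⊎_; inj₁; inj₂; [_,_]; [_,_]′)
open import Data.Unit.Base using (⊤; tt)
open import Data.Vec.Base as Vec using (Vec; []; _∷_; _++_; lookup; map; tabulate; concat)
open import Data.Vec.Properties
  using (map-id; map-cong; map-∘; map-concat; map-lookup-allFin; ∷-injective; ++-injective;
         lookup-map; lookup-++ˡ; lookup-++ʳ; lookup∘tabulate; tabulate∘lookup; tabulate-cong;
         tabulate-∘)
open import Data.Vec.Relation.Binary.Pointwise.Inductive as Pointwise
  using (Pointwise; []; _∷_)
open import Data.Vec.Relation.Unary.All as VecAll using ([]; _∷_) renaming (All to VecAll)
open import Function.Base using (_∘_; id)
open import Function.Bundles
  using (_⇔_; mk⇔; _↔_; Equivalence; Injection; Inverse; Surjection)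
open import Function.Construct.Identity using (↔-id)
open import Relation.Binary.PropositionalEquality
  using (_≡_; refl; sym; trans; cong; cong₂; subst)
open import Relation.Nullary using (¬_; yes; no; contradiction)
open import Relation.Nullary.Decidable using (decidable-stable)
open import Relation.Unary using (Pred; U)

open Structure using (Carrier)
open Endomorphism using (fun)
open Equivalence using (to; from)

-- The code of an element must survive every endomorphism, and endomorphisms may collapse
-- inequalities. Hence the relevant block cannot be marked by an inequality, whereas constancy of
-- the other blocks is preserved.
--
-- End 𝔄 need not be compact. But composing both members of a pair (σ, τ) with the same automorphism
-- β changes neither their agreement on a finite set nor, since f(β) is invertible, the inequality
-- of b^f(σ) and b^f(τ). Each new value can thus be normalised within finitely many orbits, and
-- pairs violating uniformity have a limit endomorphism at which continuity fails.
--
-- An ℵ₀-categorical theory T of 𝔄 need not be complete here. Since conditions are satisfied in 𝔄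
-- itself, the constructed models inherit every sentence true in 𝔄, in particular T. Letting names
-- denote distinct elements avoids a quotient, at the price that a Henkin witness has to be compared
-- with the finitely many names already in use.

Eventually : (ℕ → Set) → Set
Eventually P = ∃[ k ] ∀ j → k ≤ j → P j

eventually-map : ∀ {P Q : ℕ → Set} → (∀ {j} → P j → Q j) → Eventually P → Eventually Q
eventually-map f (k , p) = k , λ j k≤j → f (p j k≤j)

eventually-map₂ : ∀ {P Q R : ℕ → Set} → (∀ {j} → P j → Q j → R j) →
                  Eventually P → Eventually Q → Eventually R
eventually-map₂ f (k , p) (l , q) = k ⊔ l , λ j le →
  f (p j (≤-trans (m≤m⊔n k l) le)) (q j (≤-trans (m≤n⊔m k l) le))

eventually-suc : ∀ {P : ℕ → Set} → Eventually (P ∘ suc) → Eventually P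
eventually-suc (k , p) = suc k , λ { (suc j) (s≤s le) → p j le }

-- An exhaustion by finite lists; it makes products easy without a pairing function.
Countable : Set → Set
Countable X = Σ[ E ∈ (ℕ → List X) ] ∀ x → Eventually λ k → x ∈ E k

module _ {X Y : Set} where

  countable-⊎ : Countable X → Countable Y → Countable (X ⊎ Y)
  countable-⊎ (E , e) (F , f) = (λ k → List.map inj₁ (E k) List.++ List.map inj₂ (F k)) , λ
    { (inj₁ x) → eventually-map (λ p → ∈-++⁺ˡ (∈-map⁺ inj₁ p)) (e x)
    ; (inj₂ y) → eventually-map (λ p → ∈-++⁺ʳ (List.map inj₁ (E _)) (∈-map⁺ inj₂ p)) (f y) }

  countable-× : Countable X → Countable Y → Countable (X × Y)
  countable-× (E , e) (F , f) = (λ k → cartesianProductWith _,_ (E k) (F k)) , λ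
    (x , y) → eventually-map₂ (∈-cartesianProductWith⁺ _,_) (e x) (f y)

countable-ℕ : Countable ℕ
countable-ℕ = upTo , λ n → suc n , λ j le → ∈-upTo⁺ le

countable-Fin : ∀ n → Countable (Fin n)
countable-Fin n = (λ _ → allFin n) , λ i → 0 , λ _ _ → ∈-allFin i

countable-Σ : {F : ℕ → Set} → (∀ n → Countable (F n)) → Countable (Σ ℕ F)
countable-Σ C = (λ k → concatMap (λ n → List.map (n ,_) (proj₁ (C n) k)) (upTo k)) , λ
  (n , x) → eventually-map₂
    (λ p q → ∈-concatMap⁺ (λ n → List.map (n ,_) _) (lose p (∈-map⁺ (n ,_) q)))
    (proj₂ countable-ℕ n) (proj₂ (C n) x)

allVecs : ∀ {A : Set} → List A → ∀ n → List (Vec A n)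
allVecs xs zero    = [] ∷ []
allVecs xs (suc n) = cartesianProductWith _∷_ xs (allVecs xs n)

∈-allVecs : ∀ {A : Set} {xs : List A} → (∀ x → x ∈ xs) → ∀ {n} (v : Vec A n) → v ∈ allVecs xs n
∈-allVecs c []      = here refl
∈-allVecs c (x ∷ v) = ∈-cartesianProductWith⁺ _∷_ (c x) (∈-allVecs c v)

countable-Vec : ∀ {X} → Countable X → ∀ n → Countable (Vec X n)
countable-Vec {X} (E , e) n = (λ k → allVecs (E k) n) , go
  where
  go : ∀ {n} (v : Vec X n) → Eventually λ k → v ∈ allVecs (E k) n
  go []      = 0 , λ _ _ → here refl
  go (x ∷ v) = eventually-map₂ (∈-cartesianProductWith⁺ _∷_) (e x) (go v)

retract⇒countable : ∀ {A : Set} {e : ℕ → A} {code : A → ℕ} → (∀ x → e (code x) ≡ x) → Countable A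
retract⇒countable {e = e} {code} retract = (λ k → List.map e (upTo k)) , λ x →
  suc (code x) , λ j le → subst (_∈ _) (retract x) (∈-map⁺ e (∈-upTo⁺ le))

-- Homomorphisms, isomorphisms and satisfaction

module _ {S : Signature} {M N : Structure S} {h : Carrier M → Carrier N} where

  module _ (hom : IsHomomorphism M N h) where
    open IsHomomorphism hom

    eval-hom : ∀ {n} (ρ : Vec (Carrier M) n) t → eval N (map h ρ) t ≡ h (eval M ρ t)
    eval-hom ρ (var i) = lookup-map i h ρ
    eval-hom ρ (con c) = sym (const-preserved c)

    evals-hom : ∀ {n k} (ρ : Vec (Carrier M) n) (ts : Vec (Term S n) k) →
                map (eval N (map h ρ)) ts ≡ map h (map (eval M ρ) ts)
    evals-hom ρ ts = trans (map-cong (eval-hom ρ) ts) (map-∘ h (eval M ρ) ts)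

    pe-preserved : ∀ {n} {φ : Formula S n} → IsPositiveExistential φ →
                   ∀ {ρ} → Sat M φ ρ → Sat N φ (map h ρ)
    pe-preserved ⊤′         _        = tt
    pe-preserved (s ≐ t)    {ρ} p    = trans (eval-hom ρ s) (trans (cong h p) (sym (eval-hom ρ t)))
    pe-preserved (rel r ts) {ρ} p    =
      subst (Structure.rel N r) (sym (evals-hom ρ ts)) (rel-preserved r p)
    pe-preserved (a ∧′ b)   (p , q)  = pe-preserved a p , pe-preserved b q
    pe-preserved (a ∨′ b)   (inj₁ p) = inj₁ (pe-preserved a p)
    pe-preserved (a ∨′ b)   (inj₂ q) = inj₂ (pe-preserved b q)
    pe-preserved (∃′ a)     (x , p)  = h x , pe-preserved a p

  sat-iso : IsIsomorphism M N h → ∀ {n} (φ : Formula S n) {ρ} → Sat M φ ρ ⇔ Sat N φ (map h ρ)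
  sat-iso iso = go
    where
    open IsIsomorphism iso
    go : ∀ {n} (φ : Formula S n) {ρ} → Sat M φ ρ ⇔ Sat N φ (map h ρ)
    go ⊤′ = mk⇔ id id
    go ⊥′ = mk⇔ id id
    go (s ≐ t) {ρ} = mk⇔ (pe-preserved isHomomorphism (s ≐ t)) λ p → proj₁ bijective
      (trans (sym (eval-hom isHomomorphism ρ s)) (trans p (eval-hom isHomomorphism ρ t)))
    go (rel r ts) {ρ} = mk⇔ (pe-preserved isHomomorphism (rel r ts)) λ p →
      rel-reflected r (subst (Structure.rel N r) (evals-hom isHomomorphism ρ ts) p)
    go (¬′ φ) = mk⇔ (λ ¬p q → ¬p (from (go φ) q)) λ ¬q p → ¬q (to (go φ) p)
    go (φ ∧′ ψ) = mk⇔ (λ (p , q) → to (go φ) p , to (go ψ) q)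
                      (λ (p , q) → from (go φ) p , from (go ψ) q)
    go (φ ∨′ ψ) = mk⇔ (λ { (inj₁ p) → inj₁ (to (go φ) p)   ; (inj₂ q) → inj₂ (to (go ψ) q) })
                      (λ { (inj₁ p) → inj₁ (from (go φ) p) ; (inj₂ q) → inj₂ (from (go ψ) q) })
    go (∀′ φ) {ρ} = mk⇔
      (λ p y → let x , hx = proj₂ bijective y
               in subst (λ y → Sat N φ (y ∷ map h ρ)) (hx refl) (to (go φ) (p x)))
      (λ q x → from (go φ) (q (h x)))
    go (∃′ φ) {ρ} = mk⇔
      (λ (x , p) → h x , to (go φ) p)
      (λ (y , q) → let x , hx = proj₂ bijective y
                   in x , from (go φ) (subst (λ y → Sat N φ (y ∷ map h ρ)) (sym (hx refl)) q))

module _ {S : Signature} where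
  open Signature S

  -- The closure properties consumed by isolation of types and by one-step extension of partial
  -- maps. One argument then serves positive existential formulas, giving endomorphisms, and all
  -- formulas, giving automorphisms.
  record Fragment : Set₁ where
    field
      _∈ᶠ   : ∀ {n} → Formula S n → Set
      ⊤∈   : ∀ {n} → _∈ᶠ {n} ⊤′
      ≐∈   : ∀ {n} (s t : Term S n) → (s ≐ t) ∈ᶠ
      rel∈ : ∀ {n} r (ts : Vec (Term S n) (arity r)) → rel r ts ∈ᶠ
      ∧∈   : ∀ {n} {φ ψ : Formula S n} → φ ∈ᶠ → ψ ∈ᶠ → (φ ∧′ ψ) ∈ᶠ
      ∃∈   : ∀ {n} {φ : Formula S (suc n)} → φ ∈ᶠ → (∃′ φ) ∈ᶠ

  positiveExistential : Fragment
  positiveExistential = record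
    { _∈ᶠ = IsPositiveExistential ; ⊤∈ = ⊤′ ; ≐∈ = _≐_ ; rel∈ = rel ; ∧∈ = _∧′_ ; ∃∈ = ∃′_ }

  firstOrder : Fragment
  firstOrder = record { _∈ᶠ = λ _ → ⊤ }

-- Finite partial maps as lists of pairs

module _ {A : Set} where

  map-undo : ∀ {f g : A → A} → (∀ x → g (f x) ≡ x) → ∀ {n} (xs : Vec A n) → map g (map f xs) ≡ xs
  map-undo {f} {g} inv xs = trans (sym (map-∘ g f xs)) (trans (map-cong inv xs) (map-id xs))

  -- A list of pairs is a finite partial map prolonging `xs ↦ ys`. New pairs enter at the head,
  -- where a quantifier adds its de Bruijn variable.
  firsts seconds : ∀ {n} (L : List (A × A)) → Vec A n → Vec A (List.length L + n)
  firsts  L xs = Vec.map proj₁ (Vec.fromList L) ++ xs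
  seconds L ys = Vec.map proj₂ (Vec.fromList L) ++ ys

  module _ {n} {xs ys : Vec A n} where

    position : ∀ {L a b} → (a , b) ∈ L →
               ∃[ i ] (lookup (firsts L xs) i ≡ a × lookup (seconds L ys) i ≡ b)
    position (here refl) = zero , refl , refl
    position (there p)   = let i , eqs = position p in suc i , eqs

    positions : ∀ {L m} {f : A → A} (zs : Vec A m) → All (_∈ L) (List.map (λ z → z , f z) (Vec.toList zs)) →
                ∃[ is ] (map (lookup (firsts L xs)) is ≡ zs × map (lookup (seconds L ys)) is ≡ map f zs)
    positions []       []       = [] , refl , refl
    positions (z ∷ zs) (p ∷ ps) =
      let i , eq₁ , eq₂ = position p
          is , eqs₁ , eqs₂ = positions zs ps
      in  i ∷ is , cong₂ _∷_ eq₁ eqs₁ , cong₂ _∷_ eq₂ eqs₂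

module _ {S : Signature} {M : Structure S} where
  private
    A = Carrier M

  aut-inverse : ∀ {α : Endomorphism M} → Aut M α →
    Σ[ β ∈ Endomorphism M ] ((∀ x → fun β (fun α x) ≡ x) × (∀ x → fun α (fun β x) ≡ x))
  aut-inverse {α} αaut =
    record { fun = g ; isHomomorphism = record
      { rel-preserved   = λ r {xs} p → rel-reflected r (subst (Structure.rel M r)
          (sym (map-undo right xs)) p)
      ; const-preserved = λ c →
          proj₁ bijective (trans (right _) (sym (Endomorphism.const-preserved α c))) } }
    , (λ x → proj₁ bijective (right _)) , right
    where
    open IsIsomorphism αaut
    g : A → A
    g y = proj₁ (proj₂ bijective y)
    right : ∀ y → fun α (g y) ≡ y
    right y = proj₂ (proj₂ bijective y) refl

module _ {S : Signature} (M : Structure S) where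
  private
    A = Carrier M

  Oligomorphic : Set
  Oligomorphic = ∀ n → Σ[ reps ∈ List (Vec A n) ]
    ∀ xs → Any (λ r → ∃[ α ] (Aut M α × map (fun α) r ≡ xs)) reps

  sat-rel : ∀ {n} {ρ : Vec A n} r is → Structure.rel M r (map (lookup ρ) is) ⇔ Sat M (rel r (map var is)) ρ
  sat-rel {ρ = ρ} r is = mk⇔ (subst (Structure.rel M r) (map-∘ (eval M ρ) var is))
                             (subst (Structure.rel M r) (sym (map-∘ (eval M ρ) var is)))

-- Endomorphisms are closed under pointwise limits, since each homomorphism condition involves one
-- finite tuple.
locally-endomorphism : ∀ {S} {M : Structure S} {f : Carrier M → Carrier M} →
  (∀ {k} (xs : Vec (Carrier M) k) → Σ[ σ ∈ Endomorphism M ] map (fun σ) xs ≡ map f xs) →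
  IsHomomorphism M M f
locally-endomorphism {M = M} local = record
  { rel-preserved   = λ r {xs} p → let σ , eq = local xs in
                        subst (Structure.rel M r) eq (Endomorphism.rel-preserved σ r p)
  ; const-preserved = λ c → let σ , eq = local (Structure.const M c ∷ []) in
                        trans (sym (proj₁ (∷-injective eq))) (Endomorphism.const-preserved σ c)
  }

basicSet-preserved : ∀ {S} {N : Structure S} (τ : Endomorphism N) β {ys} →
                     basicSet N β ys → basicSet N β (map (fun τ) ys)
basicSet-preserved τ universe                  _    = tt
basicSet-preserved τ diagonal     {_ ∷ _ ∷ []} refl = refl
basicSet-preserved τ (relation r)              p    = Endomorphism.rel-preserved τ r p
basicSet-preserved τ (constant c) {_ ∷ []}     refl = Endomorphism.const-preserved τ c

finite⇒oligomorphic : ∀ {S} {M : Structure S} → Finite (Carrier M) → Oligomorphic M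
finite⇒oligomorphic {M = M} (k , bij) n =
  allVecs elements n , λ xs → lose (∈-allVecs complete xs)
    (idEnd M , record { isHomomorphism = Endomorphism.isHomomorphism (idEnd M)
                      ; bijective = id , λ y → y , id
                      ; rel-reflected = λ r {xs} → subst (Structure.rel M r) (map-id xs) }
    , map-id xs)
  where
  elements = List.map (Inverse.from bij) (allFin k)
  complete : ∀ x → x ∈ elements
  complete x = subst (_∈ elements) (Inverse.strictlyInverseʳ bij x)
                     (∈-map⁺ (Inverse.from bij) (∈-allFin (Inverse.to bij x)))

-- Renaming of variables

lift : ∀ {m k} → (Fin m → Fin k) → Fin (suc m) → Fin (suc k)
lift f zero    = zero
lift f (suc i) = suc (f i)

module _ {S : Signature} where

  rename-term : ∀ {m k} → (Fin m → Fin k) → Term S m → Term S k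
  rename-term f (var i) = var (f i)
  rename-term f (con c) = con c

  rename : ∀ {m k} → (Fin m → Fin k) → Formula S m → Formula S k
  rename f ⊤′         = ⊤′
  rename f ⊥′         = ⊥′
  rename f (s ≐ t)    = rename-term f s ≐ rename-term f t
  rename f (rel r ts) = rel r (map (rename-term f) ts)
  rename f (¬′ φ)     = ¬′ rename f φ
  rename f (φ ∧′ ψ)   = rename f φ ∧′ rename f ψ
  rename f (φ ∨′ ψ)   = rename f φ ∨′ rename f ψ
  rename f (∀′ φ)     = ∀′ rename (lift f) φ
  rename f (∃′ φ)     = ∃′ rename (lift f) φ

module _ {S : Signature} (M : Structure S) where
  private
    A = Carrier M

  eval-rename : ∀ {m k} (f : Fin m → Fin k) (ρ : Vec A k) t →
                eval M ρ (rename-term f t) ≡ eval M (tabulate (lookup ρ ∘ f)) t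
  eval-rename f ρ (var i) = sym (lookup∘tabulate (lookup ρ ∘ f) i)
  eval-rename f ρ (con c) = refl

  evals-rename : ∀ {m k l} (f : Fin m → Fin k) (ρ : Vec A k) (ts : Vec (Term S m) l) →
                 map (eval M ρ) (map (rename-term f) ts) ≡ map (eval M (tabulate (lookup ρ ∘ f))) ts
  evals-rename f ρ ts = trans (sym (map-∘ (eval M ρ) (rename-term f) ts)) (map-cong (eval-rename f ρ) ts)

  sat-rename : ∀ {m k} (f : Fin m → Fin k) φ (ρ : Vec A k) →
               Sat M (rename f φ) ρ ⇔ Sat M φ (tabulate (lookup ρ ∘ f))
  sat-rename f ⊤′ ρ = mk⇔ id id
  sat-rename f ⊥′ ρ = mk⇔ id id
  sat-rename f (s ≐ t) ρ = mk⇔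
    (λ p → trans (sym (eval-rename f ρ s)) (trans p (eval-rename f ρ t)))
    (λ p → trans (eval-rename f ρ s) (trans p (sym (eval-rename f ρ t))))
  sat-rename f (rel r ts) ρ = mk⇔ (subst (Structure.rel M r) (evals-rename f ρ ts))
                                  (subst (Structure.rel M r) (sym (evals-rename f ρ ts)))
  sat-rename f (¬′ φ) ρ = mk⇔ (λ ¬p p → ¬p (from (sat-rename f φ ρ) p)) (λ ¬p p → ¬p (to (sat-rename f φ ρ) p))
  sat-rename f (φ ∧′ ψ) ρ = mk⇔
    (λ (p , q) → to (sat-rename f φ ρ) p , to (sat-rename f ψ ρ) q)
    (λ (p , q) → from (sat-rename f φ ρ) p , from (sat-rename f ψ ρ) q)
  sat-rename f (φ ∨′ ψ) ρ = mk⇔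
    [ (λ p → inj₁ (to (sat-rename f φ ρ) p)) , (λ q → inj₂ (to (sat-rename f ψ ρ) q)) ]′
    [ (λ p → inj₁ (from (sat-rename f φ ρ) p)) , (λ q → inj₂ (from (sat-rename f ψ ρ) q)) ]′
  sat-rename f (∀′ φ) ρ = mk⇔ (λ p x → to (sat-rename (lift f) φ (x ∷ ρ)) (p x))
                              (λ p x → from (sat-rename (lift f) φ (x ∷ ρ)) (p x))
  sat-rename f (∃′ φ) ρ = mk⇔ (λ (x , p) → x , to (sat-rename (lift f) φ (x ∷ ρ)) p)
                              (λ (x , p) → x , from (sat-rename (lift f) φ (x ∷ ρ)) p)

map-agree : ∀ {A B : Set} {P : A → Set} {f g : A → B} → (∀ {x} → P x → f x ≡ g x) →
            ∀ {n} {xs : Vec A n} → VecAll P xs → map f xs ≡ map g xs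
map-agree eq []       = refl
map-agree eq (p ∷ ps) = cong₂ _∷_ (eq p) (map-agree eq ps)

below-bound : (f : ℕ → ℕ) → ∀ K → ∃[ B ] ∀ {j} → j < K → f j < B
below-bound f zero    = 0 , λ ()
below-bound f (suc K) =
  let B , below = below-bound f K
  in  B ⊔ suc (f K) , λ j<1+K → [ (λ j<K → <-≤-trans (below j<K) (m≤m⊔n _ _))
                                , (λ { refl → m≤n⊔m B _ }) ] (m<1+n⇒m<n∨m≡n j<1+K)

concat-injective : ∀ {A : Set} {n k} (xss yss : Vec (Vec A n) k) → concat xss ≡ concat yss → xss ≡ yss
concat-injective []         []         _  = refl
concat-injective (xs ∷ xss) (ys ∷ yss) eq =
  let eq₁ , eq₂ = ++-injective xs ys eq in cong₂ _∷_ eq₁ (concat-injective xss yss eq₂)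

Constant : ∀ {A : Set} {m} → Vec A m → Set
Constant v = ∃[ z ] ∀ i → lookup v i ≡ z

-- A surjection from ℕ with a chosen section treats finite and infinite structures alike; in the
-- finite case numbers that are no codes get a default value.
enumeration : ∀ {S} {M : Structure S} → Isℵ₀Categorical M →
              ∃[ e ] ∃[ code ] ∀ (x : Carrier M) → e (code x) ≡ x
enumeration {M = M} (inj₁ (n , bij)) = e , toℕ ∘ Inverse.to bij , retract
  where
  e : ℕ → Carrier M
  e j with j <? n
  ... | yes j<n = Inverse.from bij (fromℕ< j<n)
  ... | no _    = Structure.nonempty M
  retract : ∀ x → e (toℕ (Inverse.to bij x)) ≡ x
  retract x with toℕ (Inverse.to bij x) <? n
  ... | yes lt = trans (cong (Inverse.from bij) (fromℕ<-toℕ (Inverse.to bij x) lt)) (Inverse.strictlyInverseʳ bij x)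
  ... | no ¬lt = contradiction (toℕ<n (Inverse.to bij x)) ¬lt
enumeration (inj₂ (bij , _)) = Inverse.from bij , Inverse.to bij , Inverse.strictlyInverseʳ bij

-- Classical principles and a pigeonhole lemma

module _ (em : ∀ ℓ → ExcludedMiddle ℓ) where

  byContradiction : ∀ {P : Set} → ¬ ¬ P → P
  byContradiction = decidable-stable (em _)

  ¬∀⇒∃¬ : ∀ {A : Set} {P : A → Set} → ¬ (∀ x → P x) → ∃[ x ] ¬ P x
  ¬∀⇒∃¬ ¬∀ = byContradiction λ ¬∃ → ¬∀ λ x → byContradiction λ ¬Px → ¬∃ (x , ¬Px)

  ¬→⇒× : ∀ {A B : Set} → ¬ (A → B) → A × ¬ B
  ¬→⇒× ¬f = byContradiction (λ ¬a → ¬f λ a → contradiction a ¬a) , λ b → ¬f λ _ → b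

  -- By antitonicity a point that fails at level `m` fails at every later one. Dropping it leaves a
  -- list that still meets every level, because a witness at level `m ⊔ k` also serves `k`.
  pigeonhole : ∀ {A : Set} {Q : ℕ → A → Set} → (∀ {m k x} → m ≤ k → Q k x → Q m x) →
               ∀ xs → (∀ m → Any (Q m) xs) → ∃[ x ] (x ∈ xs × ∀ m → Q m x)
  pigeonhole anti [] any with any 0
  ... | ()
  pigeonhole {Q = Q} anti (x ∷ xs) any with em _ {P = ∀ m → Q m x}
  ... | yes q = x , here refl , q
  ... | no ¬q =
    let m , ¬Qm = ¬∀⇒∃¬ ¬q
        y , y∈xs , q = pigeonhole anti xs λ k → drop ¬Qm (m≤m⊔n m k) (m≤n⊔m m k) (any (m ⊔ k))
    in  y , there y∈xs , q
    where
    drop : ∀ {m k n} → ¬ Q m x → m ≤ n → k ≤ n → Any (Q n) (x ∷ xs) → Any (Q k) xs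
    drop ¬Qm m≤n k≤n (here Qn)  = contradiction (anti m≤n Qn) ¬Qm
    drop ¬Qm m≤n k≤n (there qs) = Any.map (anti k≤n) qs

  countable-↣ : ∀ {X} → AtMostCountable X → Countable X
  countable-↣ {X} f = (λ k → concatMap fibre (upTo k)) , λ x →
    eventually-map (λ p → ∈-concatMap⁺ fibre (lose p (∈-fibre x))) (proj₂ countable-ℕ (code x))
    where
    open Injection f using (injective) renaming (to to code)
    fibre : ℕ → List X
    fibre j with em _ {P = ∃[ x ] code x ≡ j}
    ... | yes (x , _) = x ∷ []
    ... | no _        = []
    ∈-fibre : ∀ x → x ∈ fibre (code x)
    ∈-fibre x with em _ {P = ∃[ y ] code y ≡ code x}
    ... | yes (y , eq) = here (sym (injective eq))
    ... | no ¬∃        = contradiction (x , refl) ¬∃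

  -- Countability of the set of formulas

  module _ (S : Signature) where
    open Signature S

    private
      rels : Countable Rel
      rels = countable-↣ rel-countable

      consts : Countable Const
      consts = countable-↣ const-countable

      countable-Term : ∀ m → Countable (Term S m)
      countable-Term m = (λ k → List.map var (proj₁ vars k) List.++ List.map con (proj₁ consts k)) , λ
        { (var i) → eventually-map (λ p → ∈-++⁺ˡ (∈-map⁺ var p)) (proj₂ vars i)
        ; (con c) → eventually-map (λ p → ∈-++⁺ʳ (List.map var (proj₁ vars 0)) (∈-map⁺ con p))
                                   (proj₂ consts c) }
        where
        vars : Countable (Fin m)
        vars = countable-Fin m

      terms : ∀ m → ℕ → List (Term S m)
      terms m = proj₁ (countable-Term m)

      atoms : ∀ m → ℕ → Rel → List (Formula S m)
      atoms m k r = List.map (rel r) (allVecs (terms m k) (arity r))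

      mutual

        formulas : ℕ → ∀ m → List (Formula S m)
        formulas zero    m = []
        formulas (suc k) m = List.concat (blocks k m)

        blocks : ℕ → ∀ m → List (List (Formula S m))
        blocks k m =
          (⊤′ ∷ ⊥′ ∷ []) ∷
          cartesianProductWith _≐_ (terms m k) (terms m k) ∷
          concatMap (atoms m k) (proj₁ rels k) ∷
          List.map ¬′_ (formulas k m) ∷
          cartesianProductWith _∧′_ (formulas k m) (formulas k m) ∷
          cartesianProductWith _∨′_ (formulas k m) (formulas k m) ∷
          List.map ∀′_ (formulas k (suc m)) ∷
          List.map ∃′_ (formulas k (suc m)) ∷ []

      ∈-formulas : ∀ {m} (φ : Formula S m) → Eventually λ k → φ ∈ formulas k m
      ∈-formulas {m} φ = eventually-suc (eventually-map (λ {k} → ∈-concat⁺ {xss = blocks k m}) (∈-blocks φ))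
        where
        ∈-blocks : ∀ {m} (φ : Formula S m) → Eventually λ k → Any (φ ∈_) (blocks k m)
        ∈-blocks ⊤′ = 0 , λ _ _ → here (here refl)
        ∈-blocks ⊥′ = 0 , λ _ _ → here (there (here refl))
        ∈-blocks {m} (s ≐ t) = eventually-map₂
          (λ p q → there (here (∈-cartesianProductWith⁺ _≐_ p q)))
          (proj₂ (countable-Term m) s) (proj₂ (countable-Term m) t)
        ∈-blocks {m} (rel r ts) = eventually-map₂
          (λ {k} p q → there (there (here (∈-concatMap⁺ (atoms m k) (lose p (∈-map⁺ (rel r) q))))))
          (proj₂ rels r) (proj₂ (countable-Vec (countable-Term m) (arity r)) ts)
        ∈-blocks (¬′ φ) = eventually-map
          (λ p → there (there (there (here (∈-map⁺ ¬′_ p))))) (∈-formulas φ)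
        ∈-blocks (φ ∧′ ψ) = eventually-map₂
          (λ p q → there (there (there (there (here (∈-cartesianProductWith⁺ _∧′_ p q))))))
          (∈-formulas φ) (∈-formulas ψ)
        ∈-blocks (φ ∨′ ψ) = eventually-map₂
          (λ p q → there (there (there (there (there (here (∈-cartesianProductWith⁺ _∨′_ p q)))))))
          (∈-formulas φ) (∈-formulas ψ)
        ∈-blocks (∀′ φ) = eventually-map
          (λ p → there (there (there (there (there (there (here (∈-map⁺ ∀′_ p))))))))
          (∈-formulas φ)
        ∈-blocks (∃′ φ) = eventually-map
          (λ p → there (there (there (there (there (there (there (here (∈-map⁺ ∃′_ p)))))))))
          (∈-formulas φ)

    countable-Formula : ∀ m → Countable (Formula S m)
    countable-Formula m = (λ k → formulas k m) , ∈-formulas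

  -- The Rasiowa–Sikorski lemma, with finite lists as conditions.
  module _ {X Q : Set} (Good : List X → Set) (Goal : Q → X → Set) (countable : Countable Q)
           (dense : ∀ q {L} → Good L → ∃[ x ] (Goal q x × Good (x ∷ L)))
           (good-[] : Good [])
           where

    private
      Condition : Set
      Condition = ∃[ L ] Good L

      fulfil : List Q → Condition → Condition
      fulfil []       C       = C
      fulfil (q ∷ qs) (L , g) =
        let x , _ , g′ = dense q g in fulfil qs (x ∷ L , g′)

      fulfil-⊆ : ∀ qs C → proj₁ C ⊆ proj₁ (fulfil qs C)
      fulfil-⊆ []       C       p = p
      fulfil-⊆ (q ∷ qs) (L , g) p = fulfil-⊆ qs _ (there p)

      fulfil-goal : ∀ {q} qs C → q ∈ qs → ∃[ x ] (x ∈ proj₁ (fulfil qs C) × Goal q x)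
      fulfil-goal (q ∷ qs) (L , g) (here refl) =
        let x , goal , g′ = dense q g in x , fulfil-⊆ qs (x ∷ L , g′) (here refl) , goal
      fulfil-goal (q ∷ qs) (L , g) (there q∈qs) = fulfil-goal qs _ q∈qs

      stage : ℕ → Condition
      stage zero    = [] , good-[]
      stage (suc k) = fulfil (proj₁ countable k) (stage k)

      stage-mono′ : ∀ {j k} → j ≤′ k → proj₁ (stage j) ⊆ proj₁ (stage k)
      stage-mono′ ≤′-refl            p = p
      stage-mono′ (≤′-step {k} j≤′k) p =
        fulfil-⊆ (proj₁ countable k) (stage k) (stage-mono′ j≤′k p)

      stage-mono : ∀ {j k} → j ≤ k → proj₁ (stage j) ⊆ proj₁ (stage k)
      stage-mono j≤k = stage-mono′ (≤⇒≤′ j≤k)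

      Γ : X → Set
      Γ x = ∃[ k ] x ∈ proj₁ (stage k)

      gather : ∀ {xs} → All Γ xs → ∃[ k ] All (_∈ proj₁ (stage k)) xs
      gather []              = 0 , []
      gather ((j , p) ∷ all) =
        let k , ps = gather all
        in  j ⊔ k , stage-mono (m≤m⊔n j k) p ∷ All.map (stage-mono (m≤n⊔m j k)) ps

    abstract
      -- It builds total maps from finite partial ones, Henkin theories from finite sets of
      -- formulas, and the limit endomorphism behind uniform continuity.
      genericFilter : Σ[ Γ ∈ (X → Set) ]
        ((∀ {xs} → All Γ xs → ∃[ L ] (Good L × All (_∈ L) xs)) × ∀ q → ∃[ x ] (Γ x × Goal q x))
      genericFilter = Γ
        , (λ all → let k , ps = gather all in proj₁ (stage k) , proj₂ (stage k) , ps)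
        , λ q → let k , eventually = proj₂ countable q
                    x , x∈L , goal = fulfil-goal (proj₁ countable k) (stage k) (eventually k ≤-refl)
                in  x , (suc k , x∈L) , goal

  -- Types, and extension of partial maps

  module _ {S : Signature} (M : Structure S) where
    open Signature S
    private
      A = Carrier M

    module _ (F : Fragment {S}) where
      open Fragment F

      -- Inclusion of `F`-types. Negation makes it symmetric for all formulas; for positive
      -- existential ones `ys` may satisfy strictly more.
      _⊑_ : ∀ {n} → Vec A n → Vec A n → Set
      xs ⊑ ys = ∀ φ → φ ∈ᶠ → Sat M φ xs → Sat M φ ys

      Isolated : ∀ {n} → Vec A n → Set
      Isolated xs = ∃[ φ ] (φ ∈ᶠ × Sat M φ xs × ∀ ys → Sat M φ ys → xs ⊑ ys)

      -- Types are constant on orbits, so finitely many have to be excluded: for each representative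
      -- not above `xs`, a formula true at `xs` and false there is conjoined.
      isolated : Oligomorphic M → ∀ {n} (xs : Vec A n) → Isolated xs
      isolated oligo {n} xs =
        let reps , cover = oligo n
            φ , φ∈ , φxs , sep = separate reps
        in  φ , φ∈ , φxs , λ ys φys ψ ψ∈ ψxs →
              let r , r∈ , α , αaut , eq = find (cover ys)
              in  subst (Sat M ψ) eq (to (sat-iso αaut ψ)
                    (All.lookup sep r∈ (from (sat-iso αaut φ) (subst (Sat M φ) (sym eq) φys)) ψ ψ∈ ψxs))
        where
        separate : ∀ rs → ∃[ φ ] (φ ∈ᶠ × Sat M φ xs × All (λ r → Sat M φ r → xs ⊑ r) rs)
        separate []       = ⊤′ , ⊤∈ , tt , []
        separate (r ∷ rs) with separate rs | em _ {P = xs ⊑ r}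
        ... | φ , φ∈ , φxs , sep | yes xs⊑r = φ , φ∈ , φxs , (λ _ → xs⊑r) ∷ sep
        ... | φ , φ∈ , φxs , sep | no xs⋢r =
          let ψ , ¬f        = ¬∀⇒∃¬ xs⋢r
              ψ∈ , ¬g       = ¬→⇒× ¬f
              ψxs , ¬ψr     = ¬→⇒× ¬g
          in  ψ ∧′ φ , ∧∈ ψ∈ φ∈ , (ψxs , φxs)
              , (λ (ψr , _) → contradiction ψr ¬ψr) ∷ All.map (λ f (_ , φr) → f φr) sep

      -- If `φ` isolates `x ∷ xs`, then `∃′ φ` holds at `xs`, hence at `ys`, and every witness of it
      -- there is an admissible image of `x`.
      forth : (∀ {n} (xs : Vec A n) → Isolated xs) →
              ∀ {n} {xs ys : Vec A n} → xs ⊑ ys → ∀ x → ∃[ y ] (x ∷ xs) ⊑ (y ∷ ys)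
      forth iso {xs = xs} xs⊑ys x =
        let φ , φ∈ , φx , sep = iso (x ∷ xs)
            y , φy = xs⊑ys (∃′ φ) (∃∈ φ∈) (x , φx)
        in  y , sep _ φy

      -- Each property of `f` involves finitely many pairs of `Γ`. One condition contains them all,
      -- and its type inclusion is applied to a single atomic formula.
      module Limit {n} {xs ys : Vec A n} {Γ : A × A → Set} (f : A → A) (f∈Γ : ∀ x → Γ (x , f x))
                   (finite : ∀ {L} → All Γ L →
                             ∃[ L′ ] (firsts L′ xs ⊑ seconds L′ ys × All (_∈ L′) L)) where

        cover : ∀ {m} (zs : Vec A m) → All Γ (List.map (λ z → z , f z) (Vec.toList zs))
        cover []       = []
        cover (z ∷ zs) = f∈Γ z ∷ cover zs

        isHomomorphism : IsHomomorphism M M f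
        isHomomorphism = record
          { rel-preserved = λ r {zs} p →
              let L , incl , ps = finite (cover zs)
                  is , eq₁ , eq₂ = positions {xs = xs} {ys} zs ps
              in  subst (Structure.rel M r) eq₂ (from (sat-rel M r is)
                    (incl _ (rel∈ r _) (to (sat-rel M r is) (subst (Structure.rel M r) (sym eq₁) p))))
          ; const-preserved = const-preserved
          }
          where
          const-preserved : ∀ c → f (Structure.const M c) ≡ Structure.const M c
          const-preserved c with L , incl , p ∷ [] ← finite (f∈Γ (Structure.const M c) ∷ [])
                            with i , eq₁ , eq₂ ← position {xs = xs} {ys} p =
            trans (sym eq₂) (incl (var i ≐ con c) (≐∈ _ _) eq₁)

        maps : map f xs ≡ ys
        maps = trans (sym (tabulate∘lookup _)) (trans (tabulate-cong at) (tabulate∘lookup ys))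
          where
          at : ∀ p → lookup (map f xs) p ≡ lookup ys p
          at p with L , incl , q ∷ [] ← finite (f∈Γ (lookup xs p) ∷ [])
               with i , eq₁ , eq₂ ← position {xs = xs} {ys} q =
            trans (lookup-map p f xs) (trans (sym eq₂)
              (trans (incl (var i ≐ var (List.length L ↑ʳ p)) (≐∈ _ _)
                        (trans eq₁ (sym (lookup-++ʳ (Vec.map proj₁ (Vec.fromList L)) xs p))))
                     (lookup-++ʳ (Vec.map proj₂ (Vec.fromList L)) ys p)))

        functional : ∀ {a b} → Γ (a , b) → f a ≡ b
        functional {a} γ with L , incl , p ∷ q ∷ [] ← finite (f∈Γ a ∷ γ ∷ [])
                         with i , eq₁ , eq₂ ← position {xs = xs} {ys} p
                            | j , eq₃ , eq₄ ← position {xs = xs} {ys} q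
                         = trans (sym eq₂) (trans (incl (var i ≐ var j) (≐∈ _ _) (trans eq₁ (sym eq₃))) eq₄)

      -- For a general fragment the inclusion has no converse. Only the forth half of back-and-forth
      -- is available, so the limit may be neither injective nor surjective.
      extend-to-endomorphism : Countable A → (∀ {n} (xs : Vec A n) → Isolated xs) →
        ∀ {n} {xs ys : Vec A n} → xs ⊑ ys → Σ[ σ ∈ Endomorphism M ] map (fun σ) xs ≡ ys
      extend-to-endomorphism countable iso {xs = xs} {ys} xs⊑ys
        with genericFilter (λ L → firsts L xs ⊑ seconds L ys) (λ x (a , _) → a ≡ x) countable
               (λ x incl → let y , incl′ = forth iso incl x in (x , y) , refl , incl′) xs⊑ys
      ... | Γ , finite , total = record { fun = f ; isHomomorphism = isHomomorphism } , maps
        where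
        f : A → A
        f x = proj₂ (proj₁ (total x))
        f∈Γ : ∀ x → Γ (x , f x)
        f∈Γ x with total x
        ... | _ , γ , refl = γ
        open Limit f f∈Γ finite

    ⊑-sym : ∀ {n} {xs ys : Vec A n} → _⊑_ firstOrder xs ys → _⊑_ firstOrder ys xs
    ⊑-sym incl φ _ φys = byContradiction λ ¬φxs → incl (¬′ φ) tt ¬φxs φys

    -- Back-and-forth: by symmetry of `⊑` a back step is a forth step for the reversed pair. The
    -- same symmetry gives injectivity and reflection of relations.
    extend-to-automorphism : Countable A → (∀ {n} (xs : Vec A n) → Isolated firstOrder xs) →
      ∀ {n} {xs ys : Vec A n} → _⊑_ firstOrder xs ys → ∃[ α ] (Aut M α × map (fun α) xs ≡ ys)
    extend-to-automorphism countable iso {xs = xs} {ys} xs⊑ys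
      with genericFilter {Q = A ⊎ A} (λ L → _⊑_ firstOrder (firsts L xs) (seconds L ys))
             (λ { (inj₁ x) (a , _) → a ≡ x ; (inj₂ y) (_ , b) → b ≡ y })
             (countable-⊎ countable countable)
             (λ { (inj₁ x) incl → let y , incl′ = forth firstOrder iso incl x in (x , y) , refl , incl′
                ; (inj₂ y) incl → let x , incl′ = forth firstOrder iso (⊑-sym incl) y
                                  in (x , y) , refl , ⊑-sym incl′ })
             xs⊑ys
    ... | Γ , finite , total =
      record { fun = f ; isHomomorphism = isHomomorphism }
      , record { isHomomorphism = isHomomorphism
               ; bijective = injective , surjective
               ; rel-reflected = rel-reflected }
      , maps
      where
      f : A → A
      f x = proj₂ (proj₁ (total (inj₁ x)))
      f∈Γ : ∀ x → Γ (x , f x)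
      f∈Γ x with total (inj₁ x)
      ... | _ , γ , refl = γ
      open Limit firstOrder f f∈Γ finite
      injective : ∀ {a b} → f a ≡ f b → a ≡ b
      injective {a} {b} eq with L , incl , p ∷ q ∷ [] ← finite (f∈Γ a ∷ f∈Γ b ∷ [])
                           with i , eq₁ , eq₂ ← position {xs = xs} {ys} p
                              | j , eq₃ , eq₄ ← position {xs = xs} {ys} q
                           = trans (sym eq₁) (trans (⊑-sym incl (var i ≐ var j) tt
                               (trans eq₂ (trans eq (sym eq₄)))) eq₃)
      surjective : ∀ b → ∃[ a ] ∀ {z} → z ≡ a → f z ≡ b
      surjective b with total (inj₂ b)
      ... | (a , _) , γ , refl = a , λ { refl → functional γ }
      rel-reflected : ∀ r {zs} → Structure.rel M r (map f zs) → Structure.rel M r zs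
      rel-reflected r {zs} p =
        let L , incl , ps = finite (cover zs)
            is , eq₁ , eq₂ = positions {xs = xs} {ys} zs ps
        in  subst (Structure.rel M r) eq₁ (from (sat-rel M r is)
              (⊑-sym incl _ tt (to (sat-rel M r is) (subst (Structure.rel M r) (sym eq₂) p))))

    -- `R` is defined by the disjunction of the isolating formulas of the orbit representatives in
    -- `R`. The positive existential type of a tuple satisfying one of them includes that of the
    -- representative, so the tuple is its image under an endomorphism, which preserves `R`.
    pe-definable : Countable A → Oligomorphic M → ∀ {n} (R : Vec A n → Set) →
      (∀ (σ : Endomorphism M) {xs} → R xs → R (map (fun σ) xs)) →
      ∃[ φ ] (IsPositiveExistential φ × ∀ xs → Sat M φ xs ⇔ R xs)
    pe-definable countable oligo {n} R preserved =
      let reps , cover = oligo n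
          φ , pe , sound , complete = collect reps
      in  φ , pe , λ xs → mk⇔ (sound xs) λ Rxs →
            let r , r∈ , α , αaut , eq = find (cover xs)
                α⁻¹ , inv , _ = aut-inverse {α = α} αaut
            in  subst (Sat M φ) eq (pe-preserved (IsIsomorphism.isHomomorphism αaut) pe
                  (All.lookup complete r∈ (subst R (trans (cong (map (fun α⁻¹)) (sym eq)) (map-undo inv r))
                     (preserved α⁻¹ Rxs))))
      where
      iso : ∀ {n} (xs : Vec A n) → Isolated positiveExistential xs
      iso = isolated positiveExistential oligo
      collect : ∀ rs → ∃[ φ ] (IsPositiveExistential φ × (∀ xs → Sat M φ xs → R xs) ×
                               All (λ r → R r → Sat M φ r) rs)
      collect [] = ⊥′ , ⊥′ , (λ _ ()) , []
      collect (r ∷ rs) with collect rs | em _ {P = R r}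
      ... | φ , pe , sound , complete | no ¬Rr = φ , pe , sound , (λ Rr → contradiction Rr ¬Rr) ∷ complete
      ... | φ , pe , sound , complete | yes Rr =
        let ψ , pe′ , ψr , sep = iso r
        in  ψ ∨′ φ , pe′ ∨′ pe
            , (λ { xs (inj₁ ψxs) → let σ , eq = extend-to-endomorphism positiveExistential countable iso (sep xs ψxs)
                                   in subst R eq (preserved σ Rr)
                 ; xs (inj₂ φxs) → sound xs φxs })
            , (λ _ → inj₁ ψr) ∷ All.map (λ f Rr → inj₂ (f Rr)) complete

  -- Henkin models

  module _ {A : Set} (bij : A ↔ ℕ) where

    private
      code = Inverse.to bij
      name = Inverse.from bij

      code∘name : ∀ j → code (name j) ≡ j
      code∘name = Inverse.strictlyInverseˡ bij

    Injective : (ℕ → A) → Set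
    Injective ρ = ∀ {i j} → ρ i ≡ ρ j → i ≡ j

    -- From `K` on the values are the elements coded by `j + B`, where `B` exceeds every code used
    -- below `K`; they are fresh and pairwise distinct.
    extend-injection : (g : ℕ → A) → ∀ K → (∀ {i j} → i < K → j < K → g i ≡ g j → i ≡ j) →
                       ∃[ ρ ] (Injective ρ × ∀ {j} → j < K → ρ j ≡ g j)
    extend-injection g K g-inj = ρ , ρ-inj , ρ-agrees
      where
      B = proj₁ (below-bound (code ∘ g) K)
      below = proj₂ (below-bound (code ∘ g) K)

      ρ : ℕ → A
      ρ j with j <? K
      ... | yes _ = g j
      ... | no _  = name (j + B)

      old≢new : ∀ {i} j → i < K → ¬ g i ≡ name (j + B)
      old≢new j i<K eq = <-irrefl (trans (cong code eq) (code∘name (j + B)))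
                                  (<-≤-trans (below i<K) (m≤n+m B j))

      ρ-inj : Injective ρ
      ρ-inj {i} {j} eq with i <? K | j <? K
      ... | yes i<K | yes j<K = g-inj i<K j<K eq
      ... | yes i<K | no _    = contradiction eq (old≢new j i<K)
      ... | no _    | yes j<K = contradiction (sym eq) (old≢new i j<K)
      ... | no _    | no _    = +-cancelʳ-≡ B i j
        (trans (sym (code∘name (i + B))) (trans (cong code eq) (code∘name (j + B))))

      ρ-agrees : ∀ {j} → j < K → ρ j ≡ g j
      ρ-agrees {j} j<K with j <? K
      ... | yes _  = refl
      ... | no j≮K = contradiction j<K j≮K

    injection : ∃[ ρ ] Injective ρ
    injection = name , λ {i} {j} eq → trans (sym (code∘name i)) (trans (cong code eq) (code∘name j))

    -- An element not yet named below K can be given the name K.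
    name-element : ∀ {ρ} → Injective ρ → ∀ K y →
                   ∃[ ρ′ ] (Injective ρ′ × (∀ {j} → j < K → ρ′ j ≡ ρ j) × ∃[ j ] (j < suc K × ρ′ j ≡ y))
    name-element {ρ} ρ-inj K y with em _ {P = ∃[ j ] (j < K × ρ j ≡ y)}
    ... | yes (j , j<K , eq) = ρ , ρ-inj , (λ _ → refl) , j , m≤n⇒m≤1+n j<K , eq
    ... | no unnamed =
      let ρ′ , ρ′-inj , agrees = extend-injection g (suc K) g-inj
      in  ρ′ , ρ′-inj , (λ j<K → trans (agrees (m≤n⇒m≤1+n j<K)) (g-below j<K))
          , K , ≤-refl , trans (agrees ≤-refl) g-at
      where
      g : ℕ → A
      g j with j <? K
      ... | yes _ = ρ j
      ... | no _  = y
      g-below : ∀ {j} → j < K → g j ≡ ρ j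
      g-below {j} j<K with j <? K
      ... | yes _  = refl
      ... | no j≮K = contradiction j<K j≮K
      g-at : g K ≡ y
      g-at with K <? K
      ... | yes K<K = contradiction K<K (<-irrefl refl)
      ... | no _    = refl
      g-inj : ∀ {i j} → i < suc K → j < suc K → g i ≡ g j → i ≡ j
      g-inj {i} {j} i<1+K j<1+K eq with m<1+n⇒m<n∨m≡n i<1+K | m<1+n⇒m<n∨m≡n j<1+K
      ... | inj₁ i<K  | inj₁ j<K  = ρ-inj (trans (sym (g-below i<K)) (trans eq (g-below j<K)))
      ... | inj₁ i<K  | inj₂ refl = contradiction (i , i<K , trans (sym (g-below i<K)) (trans eq g-at)) unnamed
      ... | inj₂ refl | inj₁ j<K  = contradiction (j , j<K , trans (sym (g-below j<K)) (trans (sym eq) g-at)) unnamed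
      ... | inj₂ refl | inj₂ refl = refl

  -- Finite conditions along a sequence of tuples

  module Worlds {S : Signature} (M : Structure S) (bij : Carrier M ↔ ℕ)
                {n} (a : ℕ → Vec (Carrier M) n) where

    private
      A = Carrier M

    Variable : Set
    Variable = Fin n ⊎ ℕ

    -- Variables in ℕ name distinct elements, so that ℕ itself can serve as the universe
    -- of the model to be built; those in Fin n name the entries of some a i.
    record World : Set where
      field
        index     : ℕ
        ρ         : ℕ → A
        injective : Injective bij ρ

      value : Variable → A
      value = [ lookup (a index) , ρ ]

    open World public

    Instance : Set
    Instance = ∃[ m ] (Formula S m × Vec Variable m)

    Holds : World → Instance → Set
    Holds w (m , φ , js) = Sat M φ (map (value w) js)

    -- Asking for worlds of arbitrarily large index makes the variables in `Fin n` stand for a limit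
    -- of the sequence `a`: whatever is forced about them holds at arbitrarily late `a i`.
    Good : List Instance → Set
    Good L = ∀ k → ∃[ w ] (k ≤ index w × All (Holds w) L)

    good-[] : Good []
    good-[] k = record { index = k ; ρ = proj₁ (injection bij) ; injective = proj₂ (injection bij) } , ≤-refl , []

    -- If `φ` cannot be added, then from some index on it fails in every world satisfying `L`, and
    -- those worlds satisfy its negation.
    refute : ∀ {L m φ js} → Good L → ¬ Good ((m , φ , js) ∷ L) → Good ((m , ¬′ φ , js) ∷ L)
    refute good ¬good k =
      let l , ¬later = ¬∀⇒∃¬ ¬good
          w , le , holds = good (k ⊔ l)
      in  w , ≤-trans (m≤m⊔n k l) le
          , (λ h → ¬later (w , ≤-trans (m≤n⊔m k l) le , h ∷ holds)) ∷ holds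

    Below : ℕ → Variable → Set
    Below K = [ (λ _ → ⊤) , _< K ]

    Bounded : ℕ → Instance → Set
    Bounded K (_ , _ , js) = VecAll (Below K) js

    below-mono : ∀ {K K′} → K ≤ K′ → ∀ {v} → Below K v → Below K′ v
    below-mono le {inj₁ _} _ = tt
    below-mono le {inj₂ _} p = ≤-trans p le

    bound-variables : ∀ {m} (js : Vec Variable m) → ∃[ K ] VecAll (Below K) js
    bound-variables [] = 0 , []
    bound-variables (v ∷ js) with bound-variables js
    bound-variables (inj₁ _ ∷ js) | K , ps = K , tt ∷ ps
    bound-variables (inj₂ j ∷ js) | K , ps =
      suc j ⊔ K , m≤m⊔n (suc j) K ∷ VecAll.map (λ {v} → below-mono (m≤n⊔m (suc j) K) {v}) ps

    bounded-mono : ∀ {K K′} → K ≤ K′ → ∀ {x} → Bounded K x → Bounded K′ x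
    bounded-mono le = VecAll.map λ {v} → below-mono le {v}

    bound : ∀ L → ∃[ K ] All (Bounded K) L
    bound [] = 0 , []
    bound (x@(_ , _ , js) ∷ L) =
      let K , p = bound-variables js
          K′ , ps = bound L
      in  K ⊔ K′ , bounded-mono (m≤m⊔n K K′) {x} p
                 ∷ All.map (λ {x} → bounded-mono (m≤n⊔m K K′) {x}) ps

    module _ {K i : ℕ} {ρ₁ ρ₂ : ℕ → A} {inj₁′ : Injective bij ρ₁} {inj₂′ : Injective bij ρ₂}
             (agree : ∀ {j} → j < K → ρ₁ j ≡ ρ₂ j) where
      private
        w₁ w₂ : World
        w₁ = record { index = i ; ρ = ρ₁ ; injective = inj₁′ }
        w₂ = record { index = i ; ρ = ρ₂ ; injective = inj₂′ }

      value-agree : ∀ {m} {js : Vec Variable m} → VecAll (Below K) js → map (value w₁) js ≡ map (value w₂) js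
      value-agree = map-agree λ { {inj₁ _} _ → refl ; {inj₂ _} p → agree p }

      holds-agree : ∀ {x} → Bounded K x → Holds w₂ x → Holds w₁ x
      holds-agree {_ , φ , _} b = subst (Sat M φ) (sym (value-agree b))

    -- In each world the witness can be named by some `j ≤ K`: by a name below `K` if it has one,
    -- else by `K`, changing `ρ` only from `K` on. Of these finitely many candidates one serves at
    -- unboundedly many indices.
    witness : ∀ {L m φ js} → Good ((m , ∃′ φ , js) ∷ L) → ∃[ j ] Good ((suc m , φ , inj₂ j ∷ js) ∷ L)
    witness {L} {m} {φ} {js} good =
      let j , _ , good′ = pigeonhole (λ le (w , p , hs) → w , ≤-trans le p , hs) (upTo (suc K)) named
      in  j , good′
      where
      x = m , ∃′ φ , js
      K = proj₁ (bound (x ∷ L))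
      bounded = proj₂ (bound (x ∷ L))
      named : ∀ k → Any (λ j → ∃[ w ] (k ≤ index w × All (Holds w) ((suc m , φ , inj₂ j ∷ js) ∷ L))) (upTo (suc K))
      named k with good k
      ... | w , le , (y , φy) ∷ holds =
        let ρ′ , ρ′-inj , agree , j , j<1+K , eq = name-element bij (injective w) K y
        in  lose (∈-upTo⁺ j<1+K)
              ( record { index = index w ; ρ = ρ′ ; injective = ρ′-inj } , le
              , subst (Sat M φ) (cong₂ _∷_ (sym eq) (sym (value-agree {inj₁′ = ρ′-inj} {injective w} agree (All.head bounded)))) φy
              ∷ All.map (λ {x} (b , h) → holds-agree {inj₁′ = ρ′-inj} {injective w} agree {x} b h)
                        (All.zip (All.tail bounded , holds)) )

    -- The requests `Q` come on top of completeness and Henkin witnesses: they carry the omission of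
    -- a type in one use and are empty in the other.
    module Henkin {Q : Set} (countable : Countable Q) (Goal : Q → Instance → Set)
                  (dense : ∀ q {L} → Good L → ∃[ x ] (Goal q x × Good (x ∷ L))) where

      private
        Request : Set
        Request = Instance ⊎ (∃[ m ] (Formula S (suc m) × Vec Variable m)) ⊎ Q

        request-countable : Countable Request
        request-countable = countable-⊎
          (countable-Σ λ m → countable-× (countable-Formula S m) (countable-Vec variables m))
          (countable-⊎
            (countable-Σ λ m → countable-× (countable-Formula S (suc m)) (countable-Vec variables m))
            countable)
          where
          variables : Countable Variable
          variables = countable-⊎ (countable-Fin n) countable-ℕ

        RequestGoal : Request → Instance → Set
        RequestGoal (inj₁ (m , φ , js)) x = x ≡ (m , φ , js) ⊎ x ≡ (m , ¬′ φ , js)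
        RequestGoal (inj₂ (inj₁ (m , φ , js))) x =
          (∃[ j ] x ≡ (suc m , φ , inj₂ j ∷ js)) ⊎ x ≡ (m , ¬′ (∃′ φ) , js)
        RequestGoal (inj₂ (inj₂ q)) x = Goal q x

        request-dense : ∀ q {L} → Good L → ∃[ x ] (RequestGoal q x × Good (x ∷ L))
        request-dense (inj₁ x) {L} good with em _ {P = Good (x ∷ L)}
        ... | yes good′ = x , inj₁ refl , good′
        ... | no ¬good  = _ , inj₂ refl , refute good ¬good
        request-dense (inj₂ (inj₁ (m , φ , js))) {L} good with em _ {P = Good ((m , ∃′ φ , js) ∷ L)}
        ... | yes good′ = let j , good″ = witness good′ in _ , inj₁ (j , refl) , good″
        ... | no ¬good  = _ , inj₂ refl , refute good ¬good
        request-dense (inj₂ (inj₂ q)) good = dense q good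

        abstract
          generic : Σ[ Γ ∈ (Instance → Set) ]
            ((∀ {xs} → All Γ xs → ∃[ L ] (Good L × All (_∈ L) xs)) × ∀ q → ∃[ x ] (Γ x × RequestGoal q x))
          generic = genericFilter Good RequestGoal request-countable request-dense good-[]

      Γ : Instance → Set
      Γ = proj₁ generic

      -- Semantic consequence of finitely many members of `Γ`, in the role of provability from `Γ`.
      Forced : (World → Set) → Set
      Forced P = ∃[ L ] (All Γ L × ∀ w → All (Holds w) L → P w)

      forced : ∀ {x} → Γ x → Forced (λ w → Holds w x)
      forced γ = _ ∷ [] , γ ∷ [] , λ { _ (h ∷ []) → h }

      always : ∀ {P : World → Set} → (∀ w → P w) → Forced P
      always p = [] , [] , λ w _ → p w

      forced-map : ∀ {P P′ : World → Set} → (∀ {w} → P w → P′ w) → Forced P → Forced P′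
      forced-map f (L , γs , p) = L , γs , λ w hs → f (p w hs)

      forced-map₂ : ∀ {P P′ P″ : World → Set} → (∀ {w} → P w → P′ w → P″ w) → Forced P → Forced P′ → Forced P″
      forced-map₂ f (L , γs , p) (L′ , γs′ , p′) =
        L List.++ L′ , ++⁺ γs γs′ , λ w hs → f (p w (++⁻ˡ L hs)) (p′ w (++⁻ʳ L hs))

      attained : ∀ {P : World → Set} → Forced P → ∀ k → ∃[ w ] (k ≤ index w × P w)
      attained (L , γs , p) k =
        let L′ , good , L⊆L′ = proj₁ (proj₂ generic) γs
            w , le , hs = good k
        in  w , le , p w (All.map (All.lookup hs) L⊆L′)

      inconsistent : ∀ {P : World → Set} → Forced P → ¬ Forced (λ w → ¬ P w)
      inconsistent p ¬p = let w , _ , h , ¬h = attained (forced-map₂ _,_ p ¬p) 0 in ¬h h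

      decide : ∀ {m} (φ : Formula S m) js →
               Forced (λ w → Sat M φ (map (value w) js)) ⊎ Forced (λ w → ¬ Sat M φ (map (value w) js))
      decide φ js with proj₂ (proj₂ generic) (inj₁ (_ , φ , js))
      ... | _ , γ , inj₁ refl = inj₁ (forced γ)
      ... | _ , γ , inj₂ refl = inj₂ (forced γ)

      henkin : ∀ {m} (φ : Formula S (suc m)) js → Forced (λ w → ∃[ y ] Sat M φ (y ∷ map (value w) js)) →
               ∃[ j ] Forced (λ w → Sat M φ (ρ w j ∷ map (value w) js))
      henkin φ js ex with proj₂ (proj₂ generic) (inj₂ (inj₁ (_ , φ , js)))
      ... | _ , γ , inj₁ (j , refl) = j , forced γ
      ... | _ , γ , inj₂ refl       = contradiction (forced γ) (inconsistent ex)

      goal-met : ∀ q → ∃[ x ] (Goal q x × Forced (λ w → Holds w x))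
      goal-met q = let x , γ , g = proj₂ (proj₂ generic) (inj₂ (inj₂ q)) in x , g , forced γ

      private
        constant-name : ∀ c → ∃[ j ] Forced (λ w → ρ w j ≡ Structure.const M c)
        constant-name c = henkin (var zero ≐ con c) [] (always λ _ → Structure.const M c , refl)

      model : Structure S
      model = record
        { Carrier  = ℕ
        ; rel      = λ r js → Forced (λ w → Structure.rel M r (map (ρ w) js))
        ; const    = λ c → proj₁ (constant-name c)
        ; nonempty = 0
        }

      private
        eval-forced : ∀ {m} (js : Vec ℕ m) t →
                      Forced (λ w → ρ w (eval model js t) ≡ eval M (map (ρ w) js) t)
        eval-forced js (var i) = always λ w → sym (lookup-map i (ρ w) js)
        eval-forced js (con c) = proj₂ (constant-name c)

        evals-forced : ∀ {m k} (js : Vec ℕ m) (ts : Vec (Term S m) k) →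
                       Forced (λ w → map (ρ w) (map (eval model js) ts) ≡ map (eval M (map (ρ w) js)) ts)
        evals-forced js []       = always λ _ → refl
        evals-forced js (t ∷ ts) = forced-map₂ (cong₂ _∷_) (eval-forced js t) (evals-forced js ts)

        values : ∀ {m} w (js : Vec ℕ m) → map (value w) (map inj₂ js) ≡ map (ρ w) js
        values w js = sym (map-∘ (value w) inj₂ js)

        decideℕ : ∀ {m} (φ : Formula S m) js →
                  Forced (λ w → Sat M φ (map (ρ w) js)) ⊎ Forced (λ w → ¬ Sat M φ (map (ρ w) js))
        decideℕ φ js with decide φ (map inj₂ js)
        ... | inj₁ p = inj₁ (forced-map (λ {w} → subst (Sat M φ) (values w js)) p)
        ... | inj₂ p = inj₂ (forced-map (λ {w} → subst (λ v → ¬ Sat M φ v) (values w js)) p)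

        henkinℕ : ∀ {m} (φ : Formula S (suc m)) js → Forced (λ w → ∃[ y ] Sat M φ (y ∷ map (ρ w) js)) →
                  ∃[ j ] Forced (λ w → Sat M φ (map (ρ w) (j ∷ js)))
        henkinℕ φ js ex =
          let j , p = henkin φ (map inj₂ js)
                        (forced-map (λ {w} → subst (λ v → ∃[ y ] Sat M φ (y ∷ v)) (sym (values w js))) ex)
          in  j , forced-map (λ {w} → subst (λ v → Sat M φ (ρ w j ∷ v)) (values w js)) p

      -- Henkin's truth lemma. Equality rests on injectivity of the naming, negation and disjunction
      -- on completeness, the existential quantifier on witnesses, and the universal one on a
      -- witness of the negated body.
      truth : ∀ {m} (φ : Formula S m) js → Sat model φ js ⇔ Forced (λ w → Sat M φ (map (ρ w) js))
      truth ⊤′ js = mk⇔ (λ _ → always λ _ → tt) (λ _ → tt)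
      truth ⊥′ js = mk⇔ (λ ()) (λ p → proj₂ (proj₂ (attained p 0)))
      truth (s ≐ t) js = mk⇔
        (λ eq → forced-map₂ (λ {w} p q → trans (sym p) (trans (cong (ρ w) eq) q)) (eval-forced js s) (eval-forced js t))
        (λ eq → let w , _ , e = attained (forced-map₂ (λ p (q , r) → trans q (trans p (sym r))) eq
                                           (forced-map₂ _,_ (eval-forced js s) (eval-forced js t))) 0
                in  injective w e)
      truth (rel r ts) js = mk⇔
        (forced-map₂ (λ eq → subst (Structure.rel M r) eq) (evals-forced js ts))
        (forced-map₂ (λ eq → subst (Structure.rel M r) (sym eq)) (evals-forced js ts))
      truth (¬′ φ) js = mk⇔
        (λ ¬p → [ (λ p → contradiction (from (truth φ js) p) ¬p) , id ]′ (decideℕ φ js))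
        (λ ¬p p → inconsistent (to (truth φ js) p) ¬p)
      truth (φ ∧′ ψ) js = mk⇔
        (λ (p , q) → forced-map₂ _,_ (to (truth φ js) p) (to (truth ψ js) q))
        (λ pq → from (truth φ js) (forced-map proj₁ pq) , from (truth ψ js) (forced-map proj₂ pq))
      truth (φ ∨′ ψ) js = mk⇔
        [ (λ p → forced-map inj₁ (to (truth φ js) p)) , (λ q → forced-map inj₂ (to (truth ψ js) q)) ]′
        (λ pq → [ (λ p → inj₁ (from (truth φ js) p))
                , (λ ¬p → inj₂ (from (truth ψ js) (forced-map₂
                    (λ ¬p → [ (λ p → contradiction p ¬p) , id ]′) ¬p pq))) ]′ (decideℕ φ js))
      truth (∀′ φ) js = mk⇔
        (λ p → [ id
               , (λ ¬p → let j , ¬q = henkinℕ (¬′ φ) js (forced-map ¬∀⇒∃¬ ¬p)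
                         in  contradiction ¬q (inconsistent (to (truth φ (j ∷ js)) (p j)))) ]′
               (decideℕ (∀′ φ) js))
        (λ p j → from (truth φ (j ∷ js)) (forced-map (λ {w} q → q (ρ w j)) p))
      truth (∃′ φ) js = mk⇔
        (λ (j , p) → forced-map (λ {w} q → ρ w j , q) (to (truth φ (j ∷ js)) p))
        (λ p → let j , q = henkinℕ φ js p in j , from (truth φ (j ∷ js)) q)

      elementary : ∀ φ → Sat M φ [] → Sat model φ []
      elementary φ p = from (truth φ []) (always λ _ → p)

  -- Omitting types and the Ryll-Nardzewski theorem

  module _ {S : Signature} (M : Structure S) where
    private
      A = Carrier M

    -- Closure properties of such predicates assemble the diagram of a condition without handling
    -- its syntax.
    Expressible : ∀ {n} → (Vec A n → Set) → Set
    Expressible P = ∃[ φ ] ∀ ρ → Sat M φ ρ ⇔ P ρ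

    module _ {n : ℕ} where

      -- A fact about indices, such as `i ≡ j`, does not depend on the assignment and enters a
      -- formula as `⊤′` or `⊥′`.
      expressible-const : ∀ X → Expressible {n} (λ _ → X)
      expressible-const X with em _ {P = X}
      ... | yes x = ⊤′ , λ _ → mk⇔ (λ _ → x) (λ _ → tt)
      ... | no ¬x = ⊥′ , λ _ → mk⇔ (λ ()) ¬x

      expressible-≡ : ∀ i j → Expressible {n} (λ ρ → lookup ρ i ≡ lookup ρ j)
      expressible-≡ i j = var i ≐ var j , λ _ → mk⇔ id id

      expressible-instance : ∀ {m} (φ : Formula S m) is → Expressible {n} (λ ρ → Sat M φ (map (lookup ρ) is))
      expressible-instance φ is = rename (lookup is) φ , λ ρ →
        subst (λ v → Sat M (rename (lookup is) φ) ρ ⇔ Sat M φ v)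
          (trans (tabulate-∘ (lookup ρ) (lookup is)) (cong (map (lookup ρ)) (tabulate∘lookup is)))
          (sat-rename M (lookup is) φ ρ)

      module _ {P Q : Vec A n → Set} where

        expressible-× : Expressible P → Expressible Q → Expressible (λ ρ → P ρ × Q ρ)
        expressible-× (φ , p) (ψ , q) = φ ∧′ ψ , λ ρ →
          mk⇔ (λ (x , y) → to (p ρ) x , to (q ρ) y) (λ (x , y) → from (p ρ) x , from (q ρ) y)

        expressible-→ : Expressible P → Expressible Q → Expressible (λ ρ → P ρ → Q ρ)
        expressible-→ (φ , p) (ψ , q) = (¬′ φ) ∨′ ψ , λ ρ →
          mk⇔ [ (λ ¬x x → contradiction (from (p ρ) x) ¬x) , (λ y _ → to (q ρ) y) ]′
              (λ f → classical (λ x → from (q ρ) (f (to (p ρ) x))))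
          where
          classical : ∀ {X Y : Set} → (X → Y) → ¬ X ⊎ Y
          classical {X} f with em _ {P = X}
          ... | yes x = inj₂ (f x)
          ... | no ¬x = inj₁ ¬x

      expressible-All : ∀ {X : Set} {P : X → Vec A n → Set} → (∀ x → Expressible (P x)) →
                        ∀ xs → Expressible (λ ρ → All (λ x → P x ρ) xs)
      expressible-All p []       = ⊤′ , λ _ → mk⇔ (λ _ → []) (λ _ → tt)
      expressible-All p (x ∷ xs) =
        let φ , eq = expressible-× (p x) (expressible-All p xs)
        in  φ , λ ρ → mk⇔ (λ s → let a , b = to (eq ρ) s in a ∷ b) (λ { (a ∷ b) → from (eq ρ) (a , b) })

      expressible-∀ : ∀ {k} {P : Fin k → Vec A n → Set} → (∀ i → Expressible (P i)) →
                      Expressible (λ ρ → ∀ i → P i ρ)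
      expressible-∀ {k} p =
        let φ , eq = expressible-All p (allFin k)
        in  φ , λ ρ → mk⇔ (λ s i → All.lookup (to (eq ρ) s) (∈-allFin i))
                          (λ f → from (eq ρ) (All.universal f (allFin k)))

    expressible-∃ : ∀ {n} k {P : Vec A (k + n) → Set} → Expressible P → Expressible (λ ρ → Σ[ u ∈ Vec A k ] P (u ++ ρ))
    expressible-∃ zero    (φ , p) = φ , λ ρ → mk⇔ (λ s → [] , to (p ρ) s) (λ { ([] , q) → from (p ρ) q })
    expressible-∃ (suc k) (φ , p) =
      let ψ , q = expressible-∃ k (∃′ φ , λ ρ → mk⇔ {B = ∃[ x ] _} (λ (x , s) → x , to (p (x ∷ ρ)) s)
                                                     (λ (x , s) → x , from (p (x ∷ ρ)) s))
      in  ψ , λ ρ → mk⇔ (λ s → let u , x , t = to (q ρ) s in x ∷ u , t)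
                        (λ { (x ∷ u , t) → from (q ρ) (u , x , t) })

  extend-tuple : ∀ {A : Set} (bij : A ↔ ℕ) {K} (u : Vec A K) → (∀ i j → lookup u i ≡ lookup u j → i ≡ j) →
                 ∃[ ρ ] (Injective bij ρ × ∀ i → ρ (toℕ i) ≡ lookup u i)
  extend-tuple {A} bij {K} u distinct =
    let ρ , ρ-inj , agrees = extend-injection bij g K λ {i} {j} i<K j<K eq →
          trans (sym (toℕ-fromℕ< i<K)) (trans (cong toℕ (distinct (fromℕ< i<K) (fromℕ< j<K)
            (trans (sym (g-below i<K)) (trans eq (g-below j<K))))) (toℕ-fromℕ< j<K))
    in  ρ , ρ-inj , λ i → trans (agrees (toℕ<n i))
                            (trans (g-below (toℕ<n i)) (cong (lookup u) (fromℕ<-toℕ i (toℕ<n i))))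
    where
    g : ℕ → A
    g j with j <? K
    ... | yes j<K = lookup u (fromℕ< j<K)
    ... | no _    = Inverse.from bij 0
    g-below : ∀ {j} (j<K : j < K) → g j ≡ lookup u (fromℕ< j<K)
    g-below {j} j<K with j <? K
    ... | yes _  = refl
    ... | no j≮K = contradiction j<K j≮K

  module Omitting {S : Signature} (M : Structure S) (bij : Carrier M ↔ ℕ)
                  {n} (b : Vec (Carrier M) n) (¬isolated : ¬ Isolated M firstOrder b) where
    private
      A = Carrier M

    open Worlds M bij {0} (λ _ → [])

    private
      FinInstance : ℕ → Set
      FinInstance K = ∃[ m ] (Formula S m × Vec (Fin K) m)

      name : ∀ {K} → Fin K → Variable
      name i = inj₂ (toℕ i)

      embed : ∀ {K} → FinInstance K → Instance
      embed (m , φ , is) = m , φ , map name is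

      restrict-variables : ∀ {K m} {js : Vec Variable m} → VecAll (Below K) js → Σ[ is ∈ Vec (Fin K) m ] map name is ≡ js
      restrict-variables []                      = [] , refl
      restrict-variables {js = inj₁ () ∷ _} _
      restrict-variables {js = inj₂ j ∷ _} (j<K ∷ ps) =
        let is , eq = restrict-variables ps
        in  fromℕ< j<K ∷ is , cong₂ _∷_ (cong inj₂ (toℕ-fromℕ< j<K)) eq

      restrict : ∀ {K} L → All (Bounded K) L → ∃[ L′ ] List.map (embed {K}) L′ ≡ L
      restrict []                 []       = [] , refl
      restrict ((m , φ , _) ∷ L) (p ∷ ps) =
        let is , eq  = restrict-variables p
            L′ , eqs = restrict L ps
        in  (m , φ , is) ∷ L′ , cong₂ _∷_ (cong (λ js → m , φ , js) eq) eqs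

      values : ∀ {K m} w (u : Vec A K) → (∀ i → ρ w (toℕ i) ≡ lookup u i) →
               (is : Vec (Fin K) m) → map (value w) (map name is) ≡ map (lookup u) is
      values w u agree is = trans (sym (map-∘ (value w) name is)) (map-cong agree is)

      module Diagram {K} (is : Vec (Fin K) n) (L : List (FinInstance K)) where

        -- `e` consists of values `u` of the `K` names followed by a second copy `c` of the values
        -- named by `is`. The duplication leaves `c` free once `u` is quantified away.
        Realises : Vec A (K + n) → Set
        Realises e = (∀ i j → lookup e (i ↑ˡ n) ≡ lookup e (j ↑ˡ n) → i ≡ j)
                   × (∀ p → lookup e (lookup is p ↑ˡ n) ≡ lookup e (K ↑ʳ p))
                   × All (λ (m , φ , js) → Sat M φ (map (lookup e) (map (_↑ˡ n) js))) L

        formula : Expressible M (λ c → Σ[ u ∈ Vec A K ] Realises (u ++ c))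
        formula = expressible-∃ M K
          (expressible-× M
            (expressible-∀ M λ i → expressible-∀ M λ j →
              expressible-→ M (expressible-≡ M (i ↑ˡ n) (j ↑ˡ n)) (expressible-const M (i ≡ j)))
          (expressible-× M
            (expressible-∀ M λ p → expressible-≡ M (lookup is p ↑ˡ n) (K ↑ʳ p))
            (expressible-All M (λ (m , φ , js) → expressible-instance M φ (map (_↑ˡ n) js)) L)))

        distinct : ∀ (u : Vec A K) c → Realises (u ++ c) → ∀ i j → lookup u i ≡ lookup u j → i ≡ j
        distinct u c (d , _) i j eq = d i j (trans (lookup-++ˡ u c i) (trans eq (sym (lookup-++ˡ u c j))))

        module _ w (u : Vec A K) (agree : ∀ i → ρ w (toℕ i) ≡ lookup u i) (c : Vec A n) where

          private
            lookups : ∀ {m} (js : Vec (Fin K) m) → map (lookup (u ++ c)) (map (_↑ˡ n) js) ≡ map (lookup u) js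
            lookups js = trans (sym (map-∘ (lookup (u ++ c)) (_↑ˡ n) js)) (map-cong (lookup-++ˡ u c) js)

          realises : map (value w) (map name is) ≡ c → All (Holds w) (List.map (embed {K}) L) → Realises (u ++ c)
          realises eq holds =
            (λ i j e → toℕ-injective (injective w (trans (agree i) (trans (sym (lookup-++ˡ u c i))
                         (trans e (trans (lookup-++ˡ u c j) (sym (agree j))))))))
            , (λ p → trans (lookup-++ˡ u c (lookup is p)) (trans (sym (lookup-map p (lookup u) is))
                       (trans (cong (λ v → lookup v p) (trans (sym (values w u agree is)) eq))
                              (sym (lookup-++ʳ u c p)))))
            , All.map (λ { {_ , φ , js} → subst (Sat M φ) (trans (values w u agree js) (sym (lookups js))) })
                      (All.map⁻ holds)

          realised : Realises (u ++ c) → map (value w) (map name is) ≡ c × All (Holds w) (List.map (embed {K}) L)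
          realised (_ , eqs , sats) =
            trans (values w u agree is) (trans (sym (tabulate∘lookup _)) (trans (tabulate-cong (λ p →
              trans (lookup-map p (lookup u) is) (trans (sym (lookup-++ˡ u c (lookup is p)))
                (trans (eqs p) (lookup-++ʳ u c p))))) (tabulate∘lookup c)))
            , All.map⁺ (All.map (λ { {_ , φ , js} →
                subst (Sat M φ) (trans (lookups js) (sym (values w u agree js))) }) sats)

      -- If `θ` fails at `b`, it serves as `χ`. Otherwise `θ` does not isolate the type of `b`, so
      -- some tuple satisfying `θ` violates a formula true at `b`, whose negation is taken.
      avoid : ∀ θ {c} → Sat M θ c → ∃[ χ ] (¬ Sat M χ b × ∃[ c ] (Sat M θ c × Sat M χ c))
      avoid θ {c} θc with em _ {P = Sat M θ b}
      ... | no ¬θb = θ , ¬θb , c , θc , θc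
      ... | yes θb =
        let c′ , ¬f        = ¬∀⇒∃¬ λ all → ¬isolated (θ , tt , θb , all)
            θc′ , ¬b⊑c′    = ¬→⇒× ¬f
            χ , ¬g         = ¬∀⇒∃¬ ¬b⊑c′
            χb , ¬χc′      = ¬→⇒× (λ h → ¬g λ _ → h)
        in  ¬′ χ , (λ ¬χb → ¬χb χb) , c′ , θc′ , ¬χc′

      -- The diagram formula `θ` describes the tuples that `is` can name in a world satisfying `L`.
      -- The realisation `c` given by `avoid` comes with values `u` of the names, and these extend
      -- to a world where `is` names `c`.
      avoid-consistently : ∀ {K} (is : Vec (Fin K) n) (L : List (FinInstance K)) → Good (List.map embed L) →
                           ∃[ χ ] (¬ Sat M χ b × Good ((n , χ , map name is) ∷ List.map embed L))
      avoid-consistently {K} is L good =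
        let open Diagram is L
            θ , θ-eq = formula
            w₀ , _ , holds₀ = good 0
            u₀ = tabulate (ρ w₀ ∘ toℕ)
            χ , ¬χb , c , θc , χc = avoid θ (from (θ-eq (map (value w₀) (map name is)))
              (u₀ , realises w₀ u₀ (λ i → sym (lookup∘tabulate (ρ w₀ ∘ toℕ) i)) _ refl holds₀))
            u , r = to (θ-eq c) θc
            ρ′ , ρ′-inj , agree = extend-tuple bij u (distinct u c r)
        in  χ , ¬χb , λ k →
              -- The tuples of the sequence are empty here, so one naming makes a world at every
              -- index `k`.
              let w = record { index = k ; ρ = ρ′ ; injective = ρ′-inj }
                  eq , holds = realised w u agree c r
              in  w , ≤-refl , subst (Sat M χ) (sym eq) χc ∷ holds

    Goal : Vec ℕ n → Instance → Set
    Goal js x = ∃[ χ ] (¬ Sat M χ b × x ≡ (n , χ , map inj₂ js))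

    abstract
      dense : ∀ js {L} → Good L → ∃[ x ] (Goal js x × Good (x ∷ L))
      dense js {L} good =
        let K , bounded = bound ((n , ⊤′ , map inj₂ js) ∷ L)
            is , is-eq = restrict-variables {K} (All.head bounded)
            L′ , L′-eq = restrict L (All.tail bounded)
            χ , ¬χb , good′ = avoid-consistently is L′ (subst Good (sym L′-eq) good)
        in  (n , χ , map inj₂ js) , (χ , ¬χb , refl)
            , subst Good (cong₂ (λ js L → (n , χ , js) ∷ L) is-eq L′-eq) good′

    private
      module Model = Henkin (countable-Vec countable-ℕ n) Goal dense

      omitted : ∀ js → ∃[ χ ] (¬ Sat M χ b × Sat Model.model χ js)
      omitted js with Model.goal-met js
      ... | _ , (χ , ¬χb , refl) , p =
        χ , ¬χb , from (Model.truth χ js)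
          (Model.forced-map (λ {w} → subst (Sat M χ) (sym (map-∘ (value w) inj₂ js))) p)

    abstract
      omitting-types : ∃[ N ] (CountablyInfinite (Carrier N) × (∀ φ → Sat M φ [] → Sat N φ []) ×
                               ∀ ys → ∃[ χ ] (¬ Sat M χ b × Sat N χ ys))
      omitting-types = Model.model , ↔-id ℕ , Model.elementary , omitted

  -- The Ryll-Nardzewski theorem

  module _ {S : Signature} {M : Structure S} (bij : Carrier M ↔ ℕ)
           {T : Theory S} (categorical : Isℵ₀CategoricalTheory T) (M⊨T : _⊨_ M T) where
    open Isℵ₀CategoricalTheory categorical using (unique)
    private
      A = Carrier M

    -- Otherwise a countably infinite model of every sentence true in `M`, hence of `T`, omits the
    -- type of `b`. By uniqueness it is isomorphic to `M`, and the image of `b` realises that type.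
    atomic : ∀ {n} (b : Vec A n) → Isolated M firstOrder b
    atomic b = byContradiction λ ¬isolated →
      let N , N↔ℕ , elementary , omitted = Omitting.omitting-types M bij b ¬isolated
          h , iso = unique M N bij N↔ℕ M⊨T (λ {φ} φ∈T → elementary φ (M⊨T φ∈T))
          χ , ¬χb , χh = omitted (map h b)
      in  ¬χb (from (sat-iso iso χ) χh)

    -- Tuples `a i` in pairwise different orbits would have a limit, named by `js` in the Henkin
    -- model. That model is isomorphic to `M`, so by `atomic` some `θ` isolates the type of the
    -- limit. Being forced, `θ` holds at arbitrarily late `a i`; two of these then share their type,
    -- hence their orbit.
    categorical⇒oligomorphic : Oligomorphic M
    categorical⇒oligomorphic n = byContradiction λ infinite →
      let open Sequence (λ reps → ¬∀⇒∃¬ λ cover → infinite (reps , cover)) in impossible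
      where
      module Sequence (new : ∀ (reps : List (Vec A n)) → Σ[ xs ∈ Vec A n ]
        ¬ Any (λ r → Σ[ α ∈ Endomorphism M ] (Aut M α × map (fun α) r ≡ xs)) reps) where

        earlier : ℕ → List (Vec A n)
        earlier zero    = []
        earlier (suc i) = proj₁ (new (earlier i)) ∷ earlier i

        a : ℕ → Vec A n
        a i = proj₁ (new (earlier i))

        a∈earlier : ∀ {i j} → suc i ≤′ j → a i ∈ earlier j
        a∈earlier ≤′-refl     = here refl
        a∈earlier (≤′-step p) = there (a∈earlier p)

        open Worlds M bij a
        open Henkin {Q = ⊥} ((λ _ → []) , λ ()) (λ ()) (λ ())

        -- Elements of the model are names in ℕ. A Henkin witness for equality with the entry `p`
        -- turns the variable `inj₁ p` into such a name.
        names : ∀ {m} (ps : Vec (Fin n) m) →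
                ∃[ js ] Forced (λ w → map (ρ w) js ≡ map (lookup (a (index w))) ps)
        names []       = [] , always λ _ → refl
        names (p ∷ ps) =
          let j , f   = henkin (var zero ≐ var (suc zero)) (inj₁ p ∷ []) (always λ w → _ , refl)
              js , fs = names ps
          in  j ∷ js , forced-map₂ (cong₂ _∷_) f fs

        impossible : ⊥
        impossible =
          let js , named = names (Vec.allFin n)
              h , iso = unique model M (↔-id ℕ) bij (λ {φ} φ∈T → elementary φ (M⊨T φ∈T)) M⊨T
              θ , _ , θb , sep = atomic (map h js)
              forced-θ = forced-map₂ (λ {w} eq → subst (Sat M θ) (trans eq (map-lookup-allFin (a (index w)))))
                           named (to (truth θ js) (from (sat-iso iso θ) θb))
              w , _ , θa    = attained forced-θ 0
              -- The second index is taken past the first, which puts the first tuple into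
              -- `earlier (index w′)`.
              w′ , lt , θa′ = attained forced-θ (suc (index w))
              same = λ φ φ∈ s → sep _ θa′ φ φ∈ (⊑-sym M (sep _ θa) φ φ∈ s)
          in  proj₂ (new (earlier (index w′)))
                (lose (a∈earlier (≤⇒≤′ lt)) (extend-to-automorphism M (retract⇒countable {e = Inverse.from bij} (Inverse.strictlyInverseʳ bij)) atomic same))

  ℵ₀-categorical⇒oligomorphic : ∀ {S} {M : Structure S} → Isℵ₀Categorical M → Oligomorphic M
  ℵ₀-categorical⇒oligomorphic {M = M} (inj₁ finite)                        = finite⇒oligomorphic {M = M} finite
  ℵ₀-categorical⇒oligomorphic         (inj₂ (bij , T , categorical , M⊨T)) =
    categorical⇒oligomorphic bij categorical M⊨T

  -- Continuity of endomorphism actions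

  module _ {S : Signature} (M : Structure S) (oligomorphic : Oligomorphic M)
           (e : ℕ → Carrier M) (code : Carrier M → ℕ) (retract : ∀ x → e (code x) ≡ x) where
    private
      A = Carrier M

    AgreeBelow : ℕ → (A → A) → (A → A) → Set
    AgreeBelow m f g = ∀ j → j < m → f (e j) ≡ g (e j)

    support : ∀ {k} (xs : Vec A k) → ∃[ m ] ∀ {f g} → AgreeBelow m f g → map f xs ≡ map g xs
    support []       = 0 , λ _ → refl
    support (x ∷ xs) =
      let m , agree = support xs
      in  suc (code x) ⊔ m , λ {f} {g} eq → cong₂ _∷_
            (trans (cong f (sym (retract x))) (trans (eq _ (m≤m⊔n _ m)) (cong g (retract x))))
            (agree λ j j<m → eq j (≤-trans j<m (m≤n⊔m (suc (code x)) m)))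

    -- Otherwise endomorphisms are constant on ever longer initial segments. Pigeonhole on the
    -- orbits of elements and composition with automorphisms bring their values to one `c`, so the
    -- constant map to `c` is a pointwise limit of endomorphisms.
    non-contractible-below : ¬ IsContractible M →
      ∃[ m ] ∀ (σ : Endomorphism M) z → ¬ AgreeBelow m (fun σ) (λ _ → z)
    non-contractible-below ¬contractible = byContradiction λ ¬∃ →
      let reps , cover = oligomorphic 1
          r , _ , locally = pigeonhole {Q = Q} anti reps λ m →
            let σ , z , agree = constant-below ¬∃ m
            in  Any.map (λ (α , αaut , eq) → σ , z , α , αaut , agree , eq) (cover (z ∷ []))
          c = lookup r zero
          isHomomorphism = locally-endomorphism λ xs →
            let m , agree = support xs
                σ , z , α , αaut , σ-agree , eq = locally m
                α⁻¹ , left , _ = aut-inverse {α = α} αaut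
            in  compEnd M σ α⁻¹ , agree λ j j<m → trans (cong (fun α⁻¹) (trans (σ-agree j j<m)
                     (sym (trans (sym (lookup-map zero (fun α) r)) (cong (λ v → lookup v zero) eq))))) (left c)
      in  ¬contractible (record { fun = λ _ → c ; isHomomorphism = isHomomorphism } , c , λ _ → refl)
      where
      Q : ℕ → Vec A 1 → Set
      Q m r = ∃[ σ ] ∃[ z ] ∃[ α ] (Aut M α × AgreeBelow m (fun {M = M} σ) (λ _ → z) × map (fun α) r ≡ z ∷ [])
      anti : ∀ {m k r} → m ≤ k → Q k r → Q m r
      anti m≤k (σ , z , α , αaut , agree , eq) = σ , z , α , αaut , (λ j j<m → agree j (≤-trans j<m m≤k)) , eq
      constant-below : ¬ (∃[ m ] ∀ (σ : Endomorphism M) z → ¬ AgreeBelow m (fun σ) (λ _ → z)) →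
                       ∀ m → ∃[ σ ] ∃[ z ] AgreeBelow m (fun {M = M} σ) (λ _ → z)
      constant-below ¬∃ m = byContradiction λ ¬c → ¬∃ (m , λ σ z agree → ¬c (σ , z , agree))

    module _ {S′ : Signature} {N : Structure S′} (F : ContinuousHomomorphism M N) where
      open ContinuousHomomorphism F
      open MonoidMorphisms (Monoid.rawMonoid (End M)) (Monoid.rawMonoid (End N)) using (module IsMonoidHomomorphism)
      open IsMonoidHomomorphism isMonoidHomomorphism using (⟦⟧-cong; homo; ε-homo)
      private
        B = Carrier N

      -- Lets an automorphism of `M` move a pair of endomorphisms without losing the inequality of
      -- their images at `b`.
      image-injective : ∀ β β⁻¹ → (∀ x → fun β⁻¹ (fun β x) ≡ x) →
                        ∀ {b c} → fun ⟦ β ⟧ b ≡ fun ⟦ β ⟧ c → b ≡ c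
      image-injective β β⁻¹ inv {b} {c} eq = trans (sym (undo b)) (trans (cong (fun ⟦ β⁻¹ ⟧) eq) (undo c))
        where
        undo : ∀ b → fun ⟦ β⁻¹ ⟧ (fun ⟦ β ⟧ b) ≡ b
        undo b = trans (sym (homo β β⁻¹ b)) (trans (⟦⟧-cong {compEnd M β β⁻¹} {idEnd M} inv b) (ε-homo b))

      module _ (b : B) where

        private
          Separated : ℕ → Endomorphism M → Endomorphism M → Set
          Separated m σ τ = AgreeBelow m (fun σ) (fun τ) × ¬ fun ⟦ σ ⟧ b ≡ fun ⟦ τ ⟧ b

          Extends : Endomorphism M → List (A × A) → Set
          Extends σ = All λ (x , y) → fun σ x ≡ y

          Good : List (A × A) → Set
          Good L = ∀ m → ∃[ σ ] ∃[ τ ] (Separated m σ τ × Extends σ L)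

          images : (L : List (A × A)) → Vec A (List.length L)
          images L = map proj₂ (Vec.fromList L)

          fixed : ∀ {f : A → A} L → map f (images L) ≡ images L → All (λ (_ , y) → f y ≡ y) L
          fixed []            _  = []
          fixed ((_ , y) ∷ L) eq = proj₁ (∷-injective eq) ∷ fixed L (proj₂ (∷-injective eq))

          -- One Aut-orbit contains fun σ x ∷ images L for pairs (σ , τ) separated at every level;
          -- automorphisms carry all these tuples to the first of them, which fixes the value at x.
          extend : ∀ x {L} → Good L → ∃[ p ] (proj₁ p ≡ x × Good (p ∷ L))
          extend x {L} good =
            let reps , cover = oligomorphic (suc (List.length L))
                r , _ , q = pigeonhole {Q = Q} anti reps λ m →
                  let σ , τ , sep , ext = good m
                  in  Any.map (λ (α , αaut , eq) → σ , τ , α , αaut , sep , ext , eq) (cover (fun σ x ∷ images L))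
                σ₀ , _ , α₀ , α₀aut , _ , _ , eq₀ = q 0
            in  (x , fun σ₀ x) , refl , λ m →
                  let σ , τ , α , αaut , (agree , differ) , ext , eq = q m
                      α⁻¹  , left  , right  = aut-inverse {α = α} αaut
                      α₀⁻¹ , left₀ , _ = aut-inverse {α = α₀} α₀aut
                      β   = compEnd M α⁻¹ α₀
                      β⁻¹ = compEnd M α₀⁻¹ α
                      β-maps : map (fun β) (fun σ x ∷ images L) ≡ fun σ₀ x ∷ images L
                      β-maps = trans (map-∘ (fun α₀) (fun α⁻¹) _)
                        (trans (cong (λ v → map (fun α₀) (map (fun α⁻¹) v)) (sym eq))
                          (trans (cong (map (fun α₀)) (map-undo left r)) eq₀))
                      inv : ∀ y → fun β⁻¹ (fun β y) ≡ y
                      inv y = trans (cong (fun α) (left₀ (fun α⁻¹ y))) (right y)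
                  in  compEnd M σ β , compEnd M τ β
                      , ( (λ j j<m → cong (fun β) (agree j j<m))
                        , λ same → differ (image-injective β β⁻¹ inv
                            (trans (sym (homo σ β b)) (trans same (homo τ β b)))) )
                      , proj₁ (∷-injective β-maps)
                      ∷ All.map (λ (s , t) → trans (cong (fun β) s) t)
                                (All.zip (ext , fixed L (proj₂ (∷-injective β-maps))))
            where
            Q : ℕ → Vec A (suc (List.length L)) → Set
            Q m r = ∃[ σ ] ∃[ τ ] ∃[ α ]
                    (Aut M α × Separated m σ τ × Extends σ L × map (fun α) r ≡ fun σ x ∷ images L)
            anti : ∀ {m k r} → m ≤ k → Q k r → Q m r
            anti m≤k (σ , τ , α , αaut , (agree , differ) , rest) =
              σ , τ , α , αaut , ((λ j j<m → agree j (≤-trans j<m m≤k)) , differ) , rest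

          graph : (A → A) → ∀ {k} → Vec A k → List (A × A)
          graph g xs = List.map (λ x → x , g x) (Vec.toList xs)

          extends-graph : ∀ {g σ k} (xs : Vec A k) {L} → Extends σ L → All (_∈ L) (graph g xs) →
                          map (fun σ) xs ≡ map g xs
          extends-graph []       ext []       = refl
          extends-graph {σ = σ} (x ∷ xs) ext (p ∷ ps) =
            cong₂ _∷_ (All.lookup ext p) (extends-graph {σ = σ} xs ext ps)

          -- The limit of the separated pairs is an endomorphism at which continuity fails.
          ¬good-[] : ¬ Good []
          ¬good-[] good-[] =
            let k , as , bs , g∈ , ⊆O = continuous O (λ {σ} → O-open {σ}) {limit} refl
                m , agree-as = support as
                L , good , as⊆L = finite (cover as)
                -- By the choice of `m` the pair agrees on `as`, where `σ` has the values of
                -- `limit`. Both images then lie in `O`, against their separation at `b`.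
                σ , τ , (agree , differ) , ext = good m
                σ-eq = trans (extends-graph {σ = σ} as ext as⊆L) g∈
                τ-eq = trans (sym (agree-as agree)) σ-eq
            in  differ (trans (⊆O {σ} σ-eq) (sym (⊆O {τ} τ-eq)))
            where
            generic = genericFilter Good (λ x p → proj₁ p ≡ x) (retract⇒countable {e = e} {code} retract) extend good-[]
            Γ = proj₁ generic
            finite : ∀ {xs} → All Γ xs → ∃[ L ] (Good L × All (_∈ L) xs)
            finite = proj₁ (proj₂ generic)
            g : A → A
            g x = proj₂ (proj₁ (proj₂ (proj₂ generic) x))
            g∈Γ : ∀ x → Γ (x , g x)
            g∈Γ x = let _ , γ , eq = proj₂ (proj₂ generic) x in subst (λ z → Γ (z , g x)) eq γ
            cover : ∀ {k} (xs : Vec A k) → All Γ (graph g xs)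
            cover []       = []
            cover (x ∷ xs) = g∈Γ x ∷ cover xs
            limit : Endomorphism M
            limit = record { fun = g ; isHomomorphism = locally-endomorphism λ xs →
              let L , good , xs⊆L = finite (cover xs)
                  σ , _ , _ , ext = good 0
              in  σ , extends-graph {σ = σ} xs ext xs⊆L }
            O : Pred (Endomorphism N) _
            O τ = fun τ b ≡ fun ⟦ limit ⟧ b
            O-open : IsOpen N O
            O-open {σ} σ∈O = 1 , b ∷ [] , fun σ b ∷ [] , refl , λ eq → trans (proj₁ (∷-injective eq)) σ∈O

        -- Continuity alone yields an `m` depending on `σ`; here one `m` serves all `σ`. If there
        -- were none, `Good []` would hold.
        uniformly-continuous : ∃[ m ] ∀ σ τ → AgreeBelow m (fun σ) (fun τ) → fun ⟦ σ ⟧ b ≡ fun ⟦ τ ⟧ b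
        uniformly-continuous = byContradiction λ ¬∃ → ¬good-[] λ m → byContradiction λ ¬sep →
          ¬∃ (m , λ σ τ agree → byContradiction λ differ → ¬sep (σ , τ , (agree , differ) , []))

  -- Interpretations induced by actions

  module _ {S S′ : Signature} {M : Structure S} {N : Structure S′}
           (oligomorphic : Oligomorphic M) (countable : Countable (Carrier M))
           (F : ContinuousHomomorphism M N)
           {k} (generator : Fin k → Carrier N)
           {m} (ā : Vec (Carrier M) m)
           (¬constant-image : ∀ (σ : Endomorphism M) → ¬ Constant (map (fun σ) ā))
           (determined : ∀ j σ τ → map (fun σ) ā ≡ map (fun τ) ā →
              fun (ContinuousHomomorphism.⟦_⟧ F σ) (generator j) ≡
              fun (ContinuousHomomorphism.⟦_⟧ F τ) (generator j))
           (generated : ∀ y → ∃[ j ] ∃[ σ ] fun (ContinuousHomomorphism.⟦_⟧ F σ) (generator j) ≡ y) where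
    open ContinuousHomomorphism F using (⟦_⟧; isMonoidHomomorphism)
    open MonoidMorphisms (Monoid.rawMonoid (End M)) (Monoid.rawMonoid (End N)) using (module IsMonoidHomomorphism)
    open IsMonoidHomomorphism isMonoidHomomorphism using (homo)
    private
      A = Carrier M
      B = Carrier N

      block : Vec A (k * m) → Fin k → Vec A m
      block x j = tabulate λ i → lookup x (combine j i)

      block-map : ∀ f x j → block (map f x) j ≡ map f (block x j)
      block-map f x j = trans (tabulate-cong λ i → lookup-map (combine j i) f x)
                              (tabulate-∘ f (λ i → lookup x (combine j i)))

      -- No endomorphism maps ā to a constant tuple, so the non-constant block marks the generator.
      data Code (x : Vec A (k * m)) : B → Set where
        code : ∀ j σ → block x j ≡ map (fun σ) ā → (∀ l → ¬ l ≡ j → Constant (block x l)) →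
               Code x (fun ⟦ σ ⟧ (generator j))

      code-functional : ∀ {x y y′} → Code x y → Code x y′ → y ≡ y′
      code-functional (code j σ eq const) (code j′ σ′ eq′ const′) with j ≟ j′
      ... | yes refl = determined j σ σ′ (trans (sym eq) eq′)
      ... | no j≢j′  = contradiction (subst Constant eq (const′ j j≢j′)) (¬constant-image σ)

      -- Constant blocks stay constant and ā^σ becomes ā^σρ, while `homo` moves the coded value in
      -- the same way.
      code-preserved : ∀ ρ {x y} → Code x y → Code (map (fun ρ) x) (fun ⟦ ρ ⟧ y)
      code-preserved ρ {x} (code j σ eq const) = subst (Code _) (homo σ ρ (generator j)) (code j (compEnd M σ ρ)
        (trans (block-map (fun ρ) x j) (trans (cong (map (fun ρ)) eq) (sym (map-∘ (fun ρ) (fun σ) ā))))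
        (λ l l≢j → let z , eqs = const l l≢j
                   in fun ρ z , λ i → trans (cong (λ v → lookup v i) (block-map (fun ρ) x l))
                        (trans (lookup-map i (fun ρ) (block x l)) (cong (fun ρ) (eqs i)))))

      entry : Fin k → Endomorphism M → Fin k × Fin m → A
      entry j σ (l , i) with l ≟ j
      ... | yes _ = lookup (map (fun σ) ā) i
      ... | no _  = Structure.nonempty M

      encode : Fin k → Endomorphism M → Vec A (k * m)
      encode j σ = tabulate λ q → entry j σ (remQuot m q)

      lookup-encode : ∀ j σ l i → lookup (block (encode j σ) l) i ≡ entry j σ (l , i)
      lookup-encode j σ l i = trans (lookup∘tabulate (λ i → lookup (encode j σ) (combine l i)) i)
        (trans (lookup∘tabulate (λ q → entry j σ (remQuot m q)) (combine l i)) (cong (entry j σ) (remQuot-combine l i)))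

      block-encode : ∀ j σ l → (l ≡ j → block (encode j σ) l ≡ map (fun σ) ā) ×
                               (¬ l ≡ j → Constant (block (encode j σ) l))
      block-encode j σ l = (λ l≡j → trans (sym (tabulate∘lookup _)) (trans
                              (tabulate-cong λ i → trans (lookup-encode j σ l i) (here-entry l≡j i)) (tabulate∘lookup _)))
                         , λ l≢j → Structure.nonempty M , λ i → trans (lookup-encode j σ l i) (away-entry l≢j i)
        where
        here-entry : l ≡ j → ∀ i → entry j σ (l , i) ≡ lookup (map (fun σ) ā) i
        here-entry l≡j i with l ≟ j
        ... | yes _  = refl
        ... | no l≢j = contradiction l≡j l≢j
        away-entry : ¬ l ≡ j → ∀ i → entry j σ (l , i) ≡ Structure.nonempty M
        away-entry l≢j i with l ≟ j
        ... | yes l≡j = contradiction l≡j l≢j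
        ... | no _    = refl

      code-total : ∀ y → ∃[ x ] Code x y
      code-total y =
        let j , σ , eq = generated y
        in  encode j σ , subst (Code _) eq
              (code j σ (proj₁ (block-encode j σ j) refl) (λ l → proj₂ (block-encode j σ l)))

      preserved⇒pe-definable : ∀ {n k} (P : Vec (Vec A n) k → Set) →
        (∀ (σ : Endomorphism M) {xss} → P xss → P (map (map (fun σ)) xss)) → PEDefinable M P
      preserved⇒pe-definable P preserved =
        let φ , φ-pe , defines = pe-definable M countable oligomorphic
              (λ x → ∃[ xss ] (concat xss ≡ x × P xss))
              (λ { σ (xss , refl , p) → map (map (fun σ)) xss , sym (map-concat (fun σ) xss) , preserved σ p })
        in  φ , φ-pe , λ xss → mk⇔
              (λ s → let yss , eq , p = to (defines (concat xss)) s in subst P (concat-injective yss xss eq) p)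
              (λ p → from (defines (concat xss)) (xss , refl , p))

      pe-preimage : ∀ {l} (P : Vec B l → Set) → (∀ (τ : Endomorphism N) {ys} → P ys → P (map (fun τ) ys)) →
                    PEDefinable M (λ xss → ∃[ ys ] (Pointwise (λ x y → Σ[ c ∈ ∃ (Code x) ] proj₁ c ≡ y) xss ys × P ys))
      pe-preimage {l} P preserved = preserved⇒pe-definable {k * m} {l} _ λ σ (ys , gs , p) →
        map (fun ⟦ σ ⟧) ys
        , Pointwise.map⁺ (λ { ((y , c) , refl) → (fun ⟦ σ ⟧ y , code-preserved σ c) , refl }) gs
        , preserved ⟦ σ ⟧ p

      pe-basic : ∀ β → PEDefinable M (λ xss → ∃[ ys ]
                   (Pointwise (λ x y → Σ[ c ∈ ∃ (Code x) ] proj₁ c ≡ y) xss ys × basicSet N β ys))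
      pe-basic β = pe-preimage {dimension β} (basicSet N β) λ τ → basicSet-preserved τ β

    coded-interpretation : PositiveExistentiallyInterpretable N M
    coded-interpretation = record
      { n         = k * m
      ; Dom       = λ x → ∃[ y ] Code x y
      ; map-onto  = record
        { to         = λ (_ , y , _) → y
        ; cong       = λ { {_ , _ , c} {_ , _ , c′} refl → code-functional c c′ }
        ; surjective = λ y → let x , c = code-total y in (x , y , c) , λ { {_ , _ , c′} refl → code-functional c′ c }
        }
      ; definable = λ β → let φ , _ , defines = pe-basic β in φ , defines
      } , pe-basic

  -- A tuple that codes finitely many generators

  module _ {S S′ : Signature} {M : Structure S} {N : Structure S′} (oligomorphic : Oligomorphic M)
           (e : ℕ → Carrier M) (index : Carrier M → ℕ) (retract : ∀ x → e (index x) ≡ x)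
           (F : ContinuousHomomorphism M N) where
    open ContinuousHomomorphism F using (⟦_⟧)
    private
      A = Carrier M
      B = Carrier N

      Agree : ℕ → (A → A) → (A → A) → Set
      Agree = AgreeBelow M oligomorphic e index retract

      agree-mono : ∀ f g {m m′} → m ≤ m′ → Agree m′ f g → Agree m f g
      agree-mono _ _ le agree j j<m = agree j (≤-trans j<m le)

      Determined : ℕ → B → Set
      Determined m b = ∀ σ τ → Agree m (fun σ) (fun τ) → fun ⟦ σ ⟧ b ≡ fun ⟦ τ ⟧ b

      all-determined : ∀ bs → ∃[ m ] All (Determined m) bs
      all-determined []       = 0 , []
      all-determined (b ∷ bs) =
        let m , d   = uniformly-continuous M oligomorphic e index retract F b
            m′ , ds = all-determined bs
        in  m ⊔ m′ , (λ σ τ agree → d σ τ (agree-mono (fun σ) (fun τ) (m≤m⊔n m m′) agree))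
            ∷ All.map (λ d σ τ agree → d σ τ (agree-mono (fun σ) (fun τ) (m≤n⊔m m m′) agree)) ds

    abstract
      -- `ā` lists the first `m ⊔ m′` elements, with `m` from non-contractibility and `m′` from
      -- uniform continuity at the members of `bs`. Both properties persist on longer initial
      -- segments.
      coding-tuple : ¬ IsContractible M → (bs : List B) → ∃[ m ] Σ[ ā ∈ Vec A m ]
        ( (∀ (σ : Endomorphism M) → ¬ Constant (map (fun σ) ā))
        × (∀ j σ τ → map (fun σ) ā ≡ map (fun τ) ā →
           fun ⟦ σ ⟧ (List.lookup bs j) ≡ fun ⟦ τ ⟧ (List.lookup bs j)) )
      coding-tuple ¬contractible bs =
        let m , ¬const = non-contractible-below M oligomorphic e index retract ¬contractible
            m′ , determined = all-determined bs
            ā : Vec A (m ⊔ m′)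
            ā = tabulate (e ∘ toℕ)
            lookup-ā : ∀ f {j} (lt : j < m ⊔ m′) → lookup (map f ā) (fromℕ< lt) ≡ f (e j)
            lookup-ā = λ f lt → trans (lookup-map (fromℕ< lt) f ā) (cong f
              (trans (lookup∘tabulate (e ∘ toℕ) (fromℕ< lt)) (cong e (toℕ-fromℕ< lt))))
        in  m ⊔ m′ , ā
            , (λ σ (z , eq) → ¬const σ z (agree-mono (fun σ) (λ _ → z) (m≤m⊔n m m′) λ j lt →
                trans (sym (lookup-ā (fun σ) lt)) (eq (fromℕ< lt))))
            , λ j σ τ eq → All.lookup determined (∈-lookup j) σ τ (agree-mono (fun σ) (fun τ) (m≤n⊔m m m′) λ i lt →
                trans (sym (lookup-ā (fun σ) lt))
                      (trans (cong (λ v → lookup v (fromℕ< lt)) eq) (lookup-ā (fun τ) lt)))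

    interpretable : ¬ IsContractible M → CoveredByFinitelyManyOrbits N (ContinuousHomomorphism.image F U) →
                    PositiveExistentiallyInterpretable N M
    interpretable ¬contractible (bs , cover) =
      let m , ā , ¬constant , determined = coding-tuple ¬contractible bs
      in  coded-interpretation oligomorphic (retract⇒countable {e = e} {index} retract) F (List.lookup bs) ā
            ¬constant determined
            λ y → let τ , (σ , _ , σ≈τ) , eq = lookup-index (cover y)
                  in  Any.index (cover y) , σ , trans (σ≈τ _) eq

  -- Actions induced by interpretations

  module _ {S S′ : Signature} {M : Structure S} {N : Structure S′} (I : Interpretation N M)
           (pe : Interpretation.IsPositiveExistentialInterpretation I) (oligomorphic : Oligomorphic M) where
    open Interpretation I
    private
      A = Carrier M
      B = Carrier N

      preimage-preserved : ∀ β (σ : Endomorphism M) xss → preimage (basicSet N β) xss →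
                           preimage (basicSet N β) (map (map (fun σ)) xss)
      preimage-preserved β σ xss p =
        let φ , φ-pe , defines = pe β
        in  to (defines _) (subst (Sat M φ) (map-concat (fun σ) xss)
              (pe-preserved (Endomorphism.isHomomorphism σ) φ-pe (from (defines xss) p)))

      graph-functional : ∀ {x y y′} → Graph x y → Graph x y′ → y ≡ y′
      graph-functional (p , refl) (p′ , refl) = Surjection.cong map-onto refl

      representative : ∀ y → ∃[ x ] Graph x y
      representative y = let (x , p) , eq = Surjection.strictlySurjective map-onto y in x , p , eq

      rep : B → Vec A n
      rep y = proj₁ (representative y)

      graph-rep : ∀ y → Graph (rep y) y
      graph-rep y = proj₂ (representative y)

      -- The domain is the preimage of `universe`, hence closed under endomorphisms.
      graph-image : ∀ σ {x y} → Graph x y → ∃[ z ] Graph (map (fun σ) x) z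
      graph-image σ {x} {y} g with preimage-preserved universe σ (x ∷ []) (y ∷ [] , g ∷ [] , tt)
      ... | z ∷ [] , g′ ∷ [] , _ = z , g′

      act : Endomorphism M → B → B
      act σ y = proj₁ (graph-image σ (graph-rep y))

      -- Independence of the representative: the kernel of the interpretation is the preimage of the
      -- diagonal, which endomorphisms preserve.
      act-graph : ∀ σ {x y} → Graph x y → Graph (map (fun σ) x) (act σ y)
      act-graph σ {x} {y} g
        with preimage-preserved diagonal σ (x ∷ rep y ∷ []) (y ∷ y ∷ [] , g ∷ graph-rep y ∷ [] , refl)
      ... | z ∷ _ ∷ [] , g₁ ∷ g₂ ∷ [] , refl =
        subst (Graph _) (graph-functional g₂ (proj₂ (graph-image σ (graph-rep y)))) g₁

      graph-map : ∀ σ {k} (ys : Vec B k) zs → Pointwise Graph (map (map (fun σ)) (map rep ys)) zs →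
                  zs ≡ map (act σ) ys
      graph-map σ []       []       []       = refl
      graph-map σ (y ∷ ys) (z ∷ zs) (g ∷ gs) =
        cong₂ _∷_ (graph-functional g (act-graph σ (graph-rep y))) (graph-map σ ys zs gs)

      graph-reps : ∀ {k} (ys : Vec B k) → Pointwise Graph (map rep ys) ys
      graph-reps []       = []
      graph-reps (y ∷ ys) = graph-rep y ∷ graph-reps ys

      act-preserves : ∀ σ β {ys} → basicSet N β ys → basicSet N β (map (act σ) ys)
      act-preserves σ β {ys} p =
        let zs , gs , q = preimage-preserved β σ (map rep ys) (ys , graph-reps ys , p)
        in  subst (basicSet N β) (graph-map σ ys zs gs) q

      ⟦_⟧ : Endomorphism M → Endomorphism N
      ⟦ σ ⟧ = record { fun = act σ ; isHomomorphism = record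
        { rel-preserved   = λ r → act-preserves σ (relation r)
        ; const-preserved = λ c → act-preserves σ (constant c) {Structure.const N c ∷ []} refl } }

      act-≡ : ∀ {σ τ} y → map (fun σ) (rep y) ≡ map (fun τ) (rep y) → act σ y ≡ act τ y
      act-≡ {σ} {τ} y eq = graph-functional
        (subst (λ x → Graph x (act σ y)) eq (act-graph σ (graph-rep y))) (act-graph τ (graph-rep y))

      maps-agree : ∀ {f g : A → A} {k} (xss : Vec (Vec A n) k) → map f (concat xss) ≡ map g (concat xss) →
                   map (map f) xss ≡ map (map g) xss
      maps-agree {f} {g} xss eq = concat-injective _ _
        (trans (sym (map-concat f xss)) (trans eq (map-concat g xss)))

      acts-≡ : ∀ {σ τ k} (ys : Vec B k) → map (map (fun σ)) (map rep ys) ≡ map (map (fun τ)) (map rep ys) →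
               map (act σ) ys ≡ map (act τ) ys
      acts-≡         []       _  = refl
      acts-≡ {σ} {τ} (y ∷ ys) eq = cong₂ _∷_ (act-≡ {σ} {τ} y (proj₁ (∷-injective eq)))
                                             (acts-≡ {σ} {τ} ys (proj₂ (∷-injective eq)))

      -- On finitely many `ys` the action of `σ` depends only on `σ` at their concatenated
      -- representatives, which supply the basic open set.
      continuous : Continuous M N ⟦_⟧
      continuous O O-open {σ} σ∈O =
        let k , ys , zs , σ∈ , ⊆O = O-open σ∈O
            xs = concat (map rep ys)
        in  _ , xs , map (fun σ) xs , refl , λ {τ} eq →
              ⊆O {⟦ τ ⟧} (trans (acts-≡ {τ} {σ} ys (maps-agree (map rep ys) eq)) σ∈)

    induced : ContinuousHomomorphism M N
    induced = record
      { ⟦_⟧ = ⟦_⟧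
      ; isMonoidHomomorphism = record
        { isMagmaHomomorphism = record
          { isRelHomomorphism = record { cong = λ {σ} {τ} eq y → act-≡ {σ} {τ} y (map-cong eq (rep y)) }
          ; homo = λ σ τ y → graph-functional (act-graph (compEnd M σ τ) (graph-rep y))
              (subst (λ x → Graph x (act τ (act σ y))) (sym (map-∘ (fun τ) (fun σ) (rep y)))
                     (act-graph τ (act-graph σ (graph-rep y))))
          }
        ; ε-homo = λ y → graph-functional (act-graph (idEnd M) (graph-rep y))
                           (subst (λ x → Graph x y) (sym (map-id (rep y))) (graph-rep y))
        }
      ; continuous = continuous
      }

    induced-cover : CoveredByFinitelyManyOrbits N (ContinuousHomomorphism.image induced (Aut M))
    induced-cover =
      let reps , cover = oligomorphic n
      in  List.map value reps , λ y → Any.map⁺ (Any.map (orbit y) (cover (rep y)))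
      where
      value : Vec A n → B
      value x with em _ {P = ∃[ y ] Graph x y}
      ... | yes (y , _) = y
      -- The default concerns only tuples outside the domain; by `reflected` their orbits contain no
      -- `rep y`.
      ... | no _        = Structure.nonempty N
      graph-value : ∀ {x y} → Graph x y → Graph x (value x)
      graph-value {x} {y} g with em _ {P = ∃[ y ] Graph x y}
      ... | yes (_ , g′) = g′
      ... | no ¬g        = contradiction (y , g) ¬g
      -- Automorphisms preserve the defining formula of the domain in both directions, so the domain
      -- is a union of orbits.
      reflected : ∀ {α : Endomorphism M} → Aut M α → ∀ {x y} → Graph (map (fun α) x) y → ∃[ z ] Graph x z
      reflected {α} αaut {x} {y} g with pe universe
      ... | φ , _ , defines
        with to (defines (x ∷ [])) (from (sat-iso αaut φ) (subst (Sat M φ) (sym (map-concat (fun α) (x ∷ [])))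
               (from (defines (map (fun α) x ∷ [])) (y ∷ [] , g ∷ [] , tt))))
      ... | z ∷ [] , g′ ∷ [] , _ = z , g′
      orbit : ∀ y {r} → ∃[ α ] (Aut M α × map (fun α) r ≡ rep y) →
              Orbit N (ContinuousHomomorphism.image induced (Aut M)) (value r) y
      orbit y {r} (α , αaut , eq) =
        let g = subst (λ x → Graph x y) (sym eq) (graph-rep y)
        in  ⟦ α ⟧ , (α , αaut , λ _ → refl)
            , graph-functional (act-graph α (graph-value (proj₂ (reflected {α} αaut g)))) g

theorem11 : (∀ ℓ → ExcludedMiddle ℓ) →
    {S S′ : Signature} (𝔄 : Structure S) (𝔅 : Structure S′) →
    Isℵ₀Categorical 𝔄 → ¬ IsContractible 𝔄 →
    let open ContinuousHomomorphism
        [1] = PositiveExistentiallyInterpretable 𝔅 𝔄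
        [2] = Σ[ f ∈ ContinuousHomomorphism 𝔄 𝔅 ] CoveredByFinitelyManyOrbits 𝔅 (image f U)
        [3] = Σ[ f ∈ ContinuousHomomorphism 𝔄 𝔅 ] CoveredByFinitelyManyOrbits 𝔅 (image f (Aut 𝔄))
    in ([1] ⇔ [2]) × ([2] ⇔ [3])
theorem11 em 𝔄 𝔅 categorical ¬contractible =
  mk⇔ (λ i → 3⇒2 (1⇒3 i)) 2⇒1 , mk⇔ (λ c → 1⇒3 (2⇒1 c)) 3⇒2
  where
  open ContinuousHomomorphism using (image)
  oligomorphic = ℵ₀-categorical⇒oligomorphic em categorical

  1⇒3 : PositiveExistentiallyInterpretable 𝔅 𝔄 →
        Σ[ f ∈ ContinuousHomomorphism 𝔄 𝔅 ] CoveredByFinitelyManyOrbits 𝔅 (image f (Aut 𝔄))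
  1⇒3 (I , pe) = induced em I pe oligomorphic , induced-cover em I pe oligomorphic

  3⇒2 : Σ[ f ∈ ContinuousHomomorphism 𝔄 𝔅 ] CoveredByFinitelyManyOrbits 𝔅 (image f (Aut 𝔄)) →
        Σ[ f ∈ ContinuousHomomorphism 𝔄 𝔅 ] CoveredByFinitelyManyOrbits 𝔅 (image f U)
  3⇒2 (f , bs , cover) = f , bs , λ c →
    Any.map (λ (τ , (σ , _ , σ≈τ) , eq) → τ , (σ , tt , σ≈τ) , eq) (cover c)

  2⇒1 : Σ[ f ∈ ContinuousHomomorphism 𝔄 𝔅 ] CoveredByFinitelyManyOrbits 𝔅 (image f U) →
        PositiveExistentiallyInterpretable 𝔅 𝔄
  2⇒1 (f , cover) =
    let e , index , retract = enumeration categorical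
    in  interpretable em oligomorphic e index retract f ¬contractible cover
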